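{- For all integers $t\geq 1$, we have $$\mathrm{EN}_{3,t}(1243)(q)=\frac{q^{3(t^2-t+1)}\left(1-q^{2t-1}-2q^{2t}+q^{3t-1}+q^{3t}\right)}{(1-q)(1-q^2)}.$$
   Context: For integers $s,t\ge 1$, $\mathrm{EN}_{s,t}$ is the rectangular poset on the label set $\{1,\ldots,st\}$ whose labels are arranged in $s$ rows of length $t$, row $i$ (for $0\le i\le s-1$) being $it+1,it+2,\ldots,it+t$, and whose order is generated by the relations $it+j<_{\mathrm{EN}} it+j+1$ for $0\le i\le s-1$, $1\le j\le t-1$, and $(i+1)t+j<_{\mathrm{EN}} it+j$ for $0\le i\le s-2$, $1\le j\le t$. A linear extension of $\mathrm{EN}_{s,t}$ is viewed as a permutation $\pi=\pi_1\cdots\pi_{st}\in S_{st}$ of the labels in which $a$ appears before $b$ whenever $a<_{\mathrm{EN}}b$. For example, the linear extensions of $\mathrm{EN}_{3,2}$ are $531642,536142,536412,563142,563412$. A permutation $\sigma=\sigma_1\cdots\sigma_n$ contains the pattern $\tau=\tau_1\cdots\tau_m\in S_m$ if there are indices $i_1<\cdots<i_m$ such that for all $j,l\in\{1,\ldots,m\}$ one has $\sigma_{i_j}<\sigma_{i_l}$ if and only if $\tau_j<\tau_l$; otherwise $\sigma$ avoids $\tau$. $\mathrm{EN}_{s,t}(\tau)$ is the set of linear extensions of $\mathrm{EN}_{s,t}$ that avoid $\tau$. An inversion of $\pi$ is a pair $(i,j)$ with $i<j$ and $\pi_i>\pi_j$, and $\mathrm{inv}(\pi)$ is the number of inversions of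 $\pi$. Finally, $\mathrm{EN}_{s,t}(\tau)(q)=\sum_{\pi\in \mathrm{EN}_{s,t}(\tau)}q^{\mathrm{inv}(\pi)}$. -}

module Defs where

open import Data.Fin.Base as Fin using (Fin; toℕ; combine)
open import Data.Fin.Properties as Fin using (any?; all?)
open import Data.Integer.Base as ℤ using (ℤ; 0ℤ; 1ℤ; +[1+_])
open import Data.List.Base as List
  using (List; []; _∷_; [_]; _++_; allFin; cartesianProduct; cartesianProductWith)
open import Data.List.Membership.Propositional using (_∈_; find; lose)
open import Data.List.Membership.Propositional.Properties
  using (∈-allFin; ∈-cartesianProductWith⁺; ∈-filter⁺; ∈-filter⁻)
open import Data.List.Relation.Unary.All as ListAll using ()
open import Data.List.Relation.Unary.AllPairs as ListAllPairs using ()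
open import Data.List.Relation.Unary.Any as Any using (here)
open import Data.List.Relation.Unary.Unique.Propositional using (Unique)
import Data.List.Relation.Unary.Unique.Propositional.Properties as Uniqueₚ
open import Data.Nat.Base using (ℕ; zero; suc; _*_)
import Data.Nat.Properties as ℕ
open import Data.Product.Base using (∃; ∃-syntax; _×_; _,_; proj₂)
open import Data.Vec.Base as Vec using (Vec; lookup)
import Data.Vec.Properties as Vec
open import Data.Vec.Relation.Unary.AllPairs using (allPairs?)
import Data.Vec.Relation.Unary.Unique.Propositional as VecUnique
open import Data.Vec.Relation.Unary.Unique.Propositional.Properties using (lookup-injective)
open import Function.Bundles using (_⇔_; mk⇔; Equivalence)
open import Relation.Binary.Construct.Closure.Transitive
  using (TransClosure) renaming ([_] to [_]⁺; _∷_ to _∷⁺_)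
open import Relation.Binary.PropositionalEquality using (_≡_; refl; sym; trans)
open import Relation.Nullary.Decidable using (Dec; map′; ¬?; _×-dec_; _→-dec_)
open import Relation.Nullary.Decidable.Core using (yes; no)
open import Relation.Nullary.Negation.Core using (¬_)
open import Relation.Unary using (Pred; Decidable)
open import Level using (0ℓ)

------------------------------------------------------------------------
-- Permutations in one-line notation

-- Letters and positions are 0-based: the letter k ∈ {1,…,n} is the element
-- of Fin n whose toℕ is k - 1.  A word of length n over n letters is a
-- permutation exactly when its letters are distinct.

Word : ℕ → ℕ → Set
Word n m = Vec (Fin n) m

IsPermutation : ∀ {n} → Pred (Word n n) 0ℓ
IsPermutation = VecUnique.Unique

isPermutation? : ∀ {n} → Decidable (IsPermutation {n})
isPermutation? = allPairs? λ x y → ¬? (x Fin.≟ y)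

words : ∀ n m → List (Word n m)
words n zero    = [ Vec.[] ]
words n (suc m) = cartesianProductWith Vec._∷_ (allFin n) (words n m)

words-complete : ∀ {n m} (w : Word n m) → w ∈ words n m
words-complete Vec.[]       = here refl
words-complete (x Vec.∷ w) =
  ∈-cartesianProductWith⁺ Vec._∷_ (∈-allFin x) (words-complete w)

words-unique : ∀ n m → Unique (words n m)
words-unique n zero    = ListAll.[] ListAllPairs.∷ ListAllPairs.[]
words-unique n (suc m) =
  Uniqueₚ.cartesianProductWith⁺ Vec._∷_ Vec.∷-injective
    (Uniqueₚ.allFin⁺ n) (words-unique n m)

anyWord? : ∀ {n m} {P : Pred (Word n m) 0ℓ} → Decidable P → Dec (∃ P)
anyWord? {n} {m} P? =
  map′ (λ p → let w , _ , pw = find p in w , pw)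
       (λ (w , pw) → lose (words-complete w) pw)
       (Any.any? P? (words n m))

inv : ∀ {n} → Word n n → ℕ
inv {n} π = List.length
  (List.filter (λ (i , j) → (i Fin.<? j) ×-dec (lookup π j Fin.<? lookup π i))
               (cartesianProduct (allFin n) (allFin n)))

Contains : ∀ {n m} → Word n n → Word m m → Set
Contains {n} {m} σ τ = ∃[ is ]
    ((∀ (j l : Fin m) → j Fin.< l → lookup is j Fin.< lookup is l)
  ×  (∀ (j l : Fin m) →
        lookup σ (lookup is j) Fin.< lookup σ (lookup is l)
          ⇔ lookup τ j Fin.< lookup τ l))

Avoids : ∀ {n m} → Word n n → Word m m → Set
Avoids σ τ = ¬ Contains σ τ

contains? : ∀ {n m} (σ : Word n n) (τ : Word m m) → Dec (Contains σ τ)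
contains? σ τ = anyWord? λ is →
        all? (λ j → all? λ l →
          (j Fin.<? l) →-dec (lookup is j Fin.<? lookup is l))
  ×-dec all? (λ j → all? λ l →
          (lookup σ (lookup is j) Fin.<? lookup σ (lookup is l))
            ⇔-dec (lookup τ j Fin.<? lookup τ l))
  where
  _⇔-dec_ : ∀ {A B : Set} → Dec A → Dec B → Dec (A ⇔ B)
  a? ⇔-dec b? = map′ (λ (f , g) → mk⇔ f g)
                     (λ e → Equivalence.to e , Equivalence.from e)
                     ((a? →-dec b?) ×-dec (b? →-dec a?))

------------------------------------------------------------------------
-- The poset EN_{s,t} and its linear extensions

-- With 0-based labels, combine i j is the label t * i + j (toℕ-combine),
-- so it sits in row i and column j.

data Generator (s t : ℕ) : Fin (s * t) → Fin (s * t) → Set where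
  row : ∀ (i : Fin s) (j j′ : Fin t) → toℕ j′ ≡ suc (toℕ j) →
        Generator s t (combine i j) (combine i j′)
  col : ∀ (i i′ : Fin s) (j : Fin t) → toℕ i′ ≡ suc (toℕ i) →
        Generator s t (combine i′ j) (combine i j)

LessEN : ∀ s t → Fin (s * t) → Fin (s * t) → Set
LessEN s t = TransClosure (Generator s t)

AppearsBefore : ∀ {n} → Word n n → Fin n → Fin n → Set
AppearsBefore {n} π a b =
  ∃[ i ] ∃[ j ] (lookup π i ≡ a × lookup π j ≡ b × i Fin.< j)

IsLinearExtension : ∀ s t → Pred (Word (s * t) (s * t)) 0ℓ
IsLinearExtension s t π =
  IsPermutation π × (∀ a b → LessEN s t a b → AppearsBefore π a b)

appearsBefore? : ∀ {n} (π : Word n n) a b → Dec (AppearsBefore π a b)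
appearsBefore? π a b = any? λ i → any? λ j →
  (lookup π i Fin.≟ a) ×-dec (lookup π j Fin.≟ b) ×-dec (i Fin.<? j)

appearsBefore-trans : ∀ {n} {π : Word n n} {a b c} → IsPermutation π →
  AppearsBefore π a b → AppearsBefore π b c → AppearsBefore π a c
appearsBefore-trans perm (i , j , πi≡a , πj≡b , i<j) (k , l , πk≡b , πl≡c , k<l)
  with refl ← lookup-injective perm j k (trans πj≡b (sym πk≡b)) =
  i , l , πi≡a , πl≡c , Fin.<-trans i<j k<l

isLinearExtension? : ∀ s t → Decidable (IsLinearExtension s t)
isLinearExtension? s t π with isPermutation? π
... | no ¬perm = no λ (perm , _) → ¬perm perm
... | yes perm = map′ to from (rows? ×-dec cols?)
  where
  Rows Cols : Set
  Rows = ∀ (i : Fin s) (j j′ : Fin t) → toℕ j′ ≡ suc (toℕ j) →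
         AppearsBefore π (combine i j) (combine i j′)
  Cols = ∀ (i i′ : Fin s) (j : Fin t) → toℕ i′ ≡ suc (toℕ i) →
         AppearsBefore π (combine i′ j) (combine i j)

  rows? : Dec Rows
  rows? = all? λ i → all? λ j → all? λ j′ →
    (toℕ j′ ℕ.≟ suc (toℕ j)) →-dec appearsBefore? π _ _

  cols? : Dec Cols
  cols? = all? λ i → all? λ i′ → all? λ j →
    (toℕ i′ ℕ.≟ suc (toℕ i)) →-dec appearsBefore? π _ _

  generator : Rows × Cols → ∀ {a b} → Generator s t a b → AppearsBefore π a b
  generator (rs , _) (row i j j′ eq) = rs i j j′ eq
  generator (_ , cs) (col i i′ j eq) = cs i i′ j eq

  closure : Rows × Cols → ∀ {a b} → LessEN s t a b → AppearsBefore π a b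
  closure rc [ g ]⁺    = generator rc g
  closure rc (g ∷⁺ gs) = appearsBefore-trans perm (generator rc g) (closure rc gs)

  to : Rows × Cols → IsLinearExtension s t π
  to rc = perm , λ _ _ → closure rc

  from : IsLinearExtension s t π → Rows × Cols
  from (_ , ext) = (λ i j j′ eq → ext _ _ [ row i j j′ eq ]⁺)
                 , (λ i i′ j eq → ext _ _ [ col i i′ j eq ]⁺)

-- EN_{s,t}(τ) as a duplicate-free list; see ∈-EN and EN-unique.

EN : ∀ s t {m} → Word m m → List (Word (s * t) (s * t))
EN s t τ = List.filter (λ π → isLinearExtension? s t π ×-dec ¬? (contains? π τ))
                       (words (s * t) (s * t))

∈-EN : ∀ s t {m} (τ : Word m m) {π} →
       π ∈ EN s t τ ⇔ (IsLinearExtension s t π × Avoids π τ)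
∈-EN s t τ {π} = mk⇔
  (λ π∈ → proj₂ (∈-filter⁻ P? {xs = words (s * t) (s * t)} π∈))
  (λ p → ∈-filter⁺ P? (words-complete π) p)
  where
  P? : Decidable (λ π → IsLinearExtension s t π × Avoids π τ)
  P? π = isLinearExtension? s t π ×-dec ¬? (contains? π τ)

EN-unique : ∀ s t {m} (τ : Word m m) → Unique (EN s t τ)
EN-unique s t τ = Uniqueₚ.filter⁺ _ (words-unique (s * t) (s * t))

------------------------------------------------------------------------
-- Polynomials in q over ℤ

-- Coefficients are listed from the constant term upwards; trailing zeros are
-- allowed, so polynomials are compared with _≈ₚ_ rather than _≡_.

Poly : Set
Poly = List ℤ

coeff : Poly → ℕ → ℤ
coeff []      _       = 0ℤ
coeff (a ∷ p) zero    = a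
coeff (a ∷ p) (suc k) = coeff p k

infix  4 _≈ₚ_ _≃_
infixl 6 _+ₚ_ _-ₚ_
infixl 7 _*ₚ_ _·ₚ_ _/ₚ_
infix  8 q^_

_≈ₚ_ : Poly → Poly → Set
p ≈ₚ r = ∀ k → coeff p k ≡ coeff r k

0ₚ 1ₚ : Poly
0ₚ = []
1ₚ = [ 1ℤ ]

q^_ : ℕ → Poly
q^ k = List.replicate k 0ℤ ++ 1ₚ

_·ₚ_ : ℤ → Poly → Poly
c ·ₚ p = List.map (c ℤ.*_) p

_+ₚ_ : Poly → Poly → Poly
[]      +ₚ r       = r
(a ∷ p) +ₚ []      = a ∷ p
(a ∷ p) +ₚ (b ∷ r) = a ℤ.+ b ∷ p +ₚ r

_-ₚ_ : Poly → Poly → Poly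
p -ₚ r = p +ₚ ℤ.-1ℤ ·ₚ r

_*ₚ_ : Poly → Poly → Poly
[]      *ₚ r = []
(a ∷ p) *ₚ r = a ·ₚ r +ₚ (0ℤ ∷ p *ₚ r)

sumₚ : List Poly → Poly
sumₚ = List.foldr _+ₚ_ 0ₚ

------------------------------------------------------------------------
-- Rational functions in q: the field of fractions of ℤ[q]

record NonZeroₚ (p : Poly) : Set where
  field
    ≉0 : ¬ (p ≈ₚ 0ₚ)

instance
  nonZeroₚ : ∀ {n p} → NonZeroₚ (+[1+ n ] ∷ p)
  nonZeroₚ = record { ≉0 = λ p≈0 → case0 (p≈0 zero) }
    where
    case0 : ∀ {n} → ¬ (+[1+ n ] ≡ 0ℤ)
    case0 ()

record RationalFunction : Set where
  constructor mkFrac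
  field
    numerator       : Poly
    denominator     : Poly
    .{{den-nonZero}} : NonZeroₚ denominator

open RationalFunction public using (numerator; denominator)

_/ₚ_ : (p d : Poly) → .{{NonZeroₚ d}} → RationalFunction
p /ₚ d = mkFrac p d

_≃_ : RationalFunction → RationalFunction → Set
f ≃ g = numerator f *ₚ denominator g ≈ₚ numerator g *ₚ denominator f

fromPoly : Poly → RationalFunction
fromPoly p = p /ₚ 1ₚ

EN[q] : ∀ s t {m} → Word m m → Poly
EN[q] s t τ = sumₚ (List.map (λ π → q^ inv π) (EN s t τ))

-- Write A, B, C for the rows of large, middle and small labels.  Avoiding 1243
-- puts every B but the first one after all the A's, and every C but the first
-- one after all the A's and B's: an A after B₁ (or an A or B after C₁), preceded
-- by the first two cells of that row, would form 1243 with the last cell of the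
-- row.  So all letters other than B₀ and C₀ occur in a forced order, and π is
-- determined by the 0-based positions a < p of B₀ and C₀, which can be any with
-- 1 ≤ a ≤ t and p ≤ 2t.  Counting inversions by their smaller letter gives
-- inv π = 3t(t − 1) + a + p, since every other B is the smaller letter of t
-- inversions and every other C of 2t.  Multiplied by (1 − q)(1 − q²), the double
-- sum of q^(inv π) telescopes.

module Submission where

open import Defs
open import Data.Bool.Base using (true; false; if_then_else_)
open import Data.Fin using (#_)
open import Data.Fin.Base as Fin
  using (Fin; toℕ; fromℕ; fromℕ<; zero; suc; punchOut; combine; splitAt; _↑ˡ_; _↑ʳ_)
open import Data.Fin.Patterns using (0F; 1F; 2F; 3F)
open import Data.Fin.Permutation using (permutation)
import Data.Fin.Properties as Fin
open import Data.Integer.Base as ℤ using (ℤ; +_; 0ℤ; 1ℤ; -1ℤ)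
import Data.Integer.Properties as ℤ
import Data.Integer.Tactic.RingSolver as ℤ-Solver
open import Data.List.Base as List
  using (List; []; _∷_; _++_; concat; cartesianProduct; filter; length; map; replicate; tabulate)
import Data.List.Properties as List
open import Data.List.Membership.Propositional using (_∈_)
open import Data.List.Membership.Propositional.Properties
  using (∈-concat⁺′; ∈-concat⁻′; ∈-tabulate⁺; ∈-tabulate⁻)
open import Data.List.Membership.Propositional.Properties.WithK using (unique∧set⇒bag)
open import Data.List.Relation.Binary.BagAndSetEquality using (∼bag⇒↭)
open import Data.List.Relation.Binary.Permutation.Propositional using (_↭_; ↭⇒↭ₛ)
open import Data.List.Relation.Binary.Permutation.Propositional.Properties using (map⁺)
import Data.List.Relation.Binary.Permutation.Setoid.Properties as ↭ₛ
import Data.List.Relation.Unary.All.Properties as All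
import Data.List.Relation.Unary.AllPairs.Properties as AllPairs
open import Data.List.Relation.Unary.Unique.Propositional using (Unique)
import Data.List.Relation.Unary.Unique.Propositional.Properties as Unique
open import Data.Nat.Base using (ℕ; zero; suc; _+_; _*_; _∸_; _^_; _≤_; _<_; _≥_; z≤n; s≤s)
import Data.Nat.Properties as ℕ
import Data.Nat.Tactic.RingSolver as ℕ-Solver
open import Data.Product.Base using (∃; ∃₂; ∃-syntax; _×_; _,_; proj₁; proj₂)
open import Data.Sum.Base using (_⊎_; inj₁; inj₂; [_,_]′)
open import Data.Sum.Properties using ([,]-map)
open import Data.Vec.Base as Vec using (Vec; []; _∷_; lookup)
import Data.Vec.Properties as Vec
open import Data.Vec.Relation.Unary.Unique.Propositional.Properties as VecUnique
  using (lookup-injective)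
open import Function.Base using (_∘_; id)
open import Function.Bundles using (_⇔_; mk⇔; Equivalence)
open import Function.Definitions using (Injective)
open import Level using (0ℓ)
open import Relation.Binary.Construct.Closure.Transitive
  using () renaming ([_] to [_]⁺; _∷_ to _∷⁺_)
open import Relation.Binary.Definitions using (tri<; tri≈; tri>)
open import Relation.Binary.PropositionalEquality
open import Relation.Nullary.Decidable using (Dec; yes; no; does; dec-true; dec-false; _×-dec_)
open import Relation.Nullary.Negation using (¬_; contradiction)
open import Relation.Unary using (Pred; Decidable)

open import Algebra.Properties.CommutativeMonoid.Sum ℕ.+-0-commutativeMonoid
  using (sum; sum-cong-≗; sum-permute; ∑-comm; sum-replicate-zero; sum-syntax)

-- Polynomials and telescoping sums

-- With a = c + 1 and p = k + c + 2, inv π is k + 2c + N, where N = 3t(t - 1) + 3 is the least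
-- value, 0 ≤ c < t and 0 ≤ k < T - c for T = 2t - 1. The inner geometric sum over k absorbs the
-- factor 1 - q and leaves (1 - q^2)(q^(2c+N) - q^(c+T+N)). In q^(2c+N) the exponent grows by 2 with
-- c, so its part is a difference of consecutive values already. In q^(c+T+N) it grows by 1 only, so
-- two neighbouring powers are needed: with G(c) = q^(2c+N) - q^(c+T+N) - q^(c+1+T+N) the expression
-- is G(c) - G(c+1), and the whole sum is G(0) - G(t). Because 2t = T + 1, the power q^(2t+N) occurs
-- in both G(0) and G(t), which is the origin of the coefficient 2 in the numerator. The identity of
-- fractions is cross-multiplied and verified one coefficient at a time, so all of this takes place
-- among integers.

coeff-+ : ∀ p r k → coeff (p +ₚ r) k ≡ coeff p k ℤ.+ coeff r k
coeff-+ []      r       k       = sym (ℤ.+-identityˡ _)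
coeff-+ (a ∷ p) []      k       = sym (ℤ.+-identityʳ _)
coeff-+ (a ∷ p) (b ∷ r) zero    = refl
coeff-+ (a ∷ p) (b ∷ r) (suc k) = coeff-+ p r k

coeff-· : ∀ c p k → coeff (c ·ₚ p) k ≡ c ℤ.* coeff p k
coeff-· c []      k       = sym (ℤ.*-zeroʳ c)
coeff-· c (a ∷ p) zero    = refl
coeff-· c (a ∷ p) (suc k) = coeff-· c p k

coeff-minus : ∀ p r k → coeff (p -ₚ r) k ≡ coeff p k ℤ.- coeff r k
coeff-minus p r k = trans (coeff-+ p _ k)
  (cong (ℤ._+_ (coeff p k)) (trans (coeff-· -1ℤ r k) (ℤ.-1*i≡-i _)))

*ₚ-distribʳ : ∀ p r d k →
  coeff ((p +ₚ r) *ₚ d) k ≡ coeff (p *ₚ d) k ℤ.+ coeff (r *ₚ d) k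
*ₚ-distribʳ []      r       d k = sym (ℤ.+-identityˡ _)
*ₚ-distribʳ (a ∷ p) []      d k = sym (ℤ.+-identityʳ _)
*ₚ-distribʳ (a ∷ p) (b ∷ r) d k
  rewrite coeff-+ ((a ℤ.+ b) ·ₚ d) (0ℤ ∷ (p +ₚ r) *ₚ d) k
        | coeff-+ (a ·ₚ d) (0ℤ ∷ p *ₚ d) k
        | coeff-+ (b ·ₚ d) (0ℤ ∷ r *ₚ d) k
        | coeff-· (a ℤ.+ b) d k | coeff-· a d k | coeff-· b d k
  = trans
    (cong (ℤ._+_ ((a ℤ.+ b) ℤ.* coeff d k)) (tails k))
    (regroup a b (coeff d k) (coeff (0ℤ ∷ p *ₚ d) k) (coeff (0ℤ ∷ r *ₚ d) k))
  where
  tails : ∀ k → coeff (0ℤ ∷ (p +ₚ r) *ₚ d) k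
              ≡ coeff (0ℤ ∷ p *ₚ d) k ℤ.+ coeff (0ℤ ∷ r *ₚ d) k
  tails zero    = refl
  tails (suc k) = *ₚ-distribʳ p r d k
  regroup : ∀ a b x y z → (a ℤ.+ b) ℤ.* x ℤ.+ (y ℤ.+ z)
                        ≡ a ℤ.* x ℤ.+ y ℤ.+ (b ℤ.* x ℤ.+ z)
  regroup = ℤ-Solver.solve-∀

*ₚ-identityʳ : ∀ p → p *ₚ 1ₚ ≈ₚ p
*ₚ-identityʳ []      k       = refl
*ₚ-identityʳ (a ∷ p) zero    = trans (ℤ.+-identityʳ _) (ℤ.*-identityʳ a)
*ₚ-identityʳ (a ∷ p) (suc k) = *ₚ-identityʳ p k

q^*-coeff : ∀ n r k → coeff (q^ n *ₚ r) k ≡ coeff (replicate n 0ℤ ++ r) k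
q^*-coeff zero    r k rewrite coeff-+ (1ℤ ·ₚ r) (0ℤ ∷ []) k | coeff-· 1ℤ r k
                            | ℤ.*-identityˡ (coeff r k) =
  trans (cong (ℤ._+_ (coeff r k)) (coeff-zero k)) (ℤ.+-identityʳ (coeff r k))
  where
  coeff-zero : ∀ k → coeff (0ℤ ∷ []) k ≡ 0ℤ
  coeff-zero zero    = refl
  coeff-zero (suc k) = refl
q^*-coeff (suc n) r k rewrite coeff-+ (0ℤ ·ₚ r) (0ℤ ∷ q^ n *ₚ r) k | coeff-· 0ℤ r k =
  trans (ℤ.+-identityˡ _) (shifted k)
  where
  shifted : ∀ k → coeff (0ℤ ∷ q^ n *ₚ r) k ≡ coeff (replicate (suc n) 0ℤ ++ r) k
  shifted zero    = refl
  shifted (suc k) = q^*-coeff n r k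


D : Poly
D = (1ₚ -ₚ q^ 1) *ₚ (1ₚ -ₚ q^ 2)

-- `D` expands to 1 - q - q^2 + q^3, and `q^ n` shifts it. The coefficients in degrees below 4 are
-- compared by evaluation; beyond them both sides vanish.
q^*D : ∀ n k → coeff (q^ n *ₚ D) k
  ≡ coeff (q^ n) k ℤ.- coeff (q^ (1 + n)) k
    ℤ.- (coeff (q^ (2 + n)) k ℤ.- coeff (q^ (3 + n)) k)
q^*D n k = trans (q^*-coeff n D k) (expand n k)
  where
  expand : ∀ n k → coeff (replicate n 0ℤ ++ D) k
    ≡ coeff (q^ n) k ℤ.- coeff (q^ (1 + n)) k
      ℤ.- (coeff (q^ (2 + n)) k ℤ.- coeff (q^ (3 + n)) k)
  expand zero    zero                      = refl
  expand zero    (suc zero)                = refl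
  expand zero    (suc (suc zero))          = refl
  expand zero    (suc (suc (suc zero)))    = refl
  expand zero    (suc (suc (suc (suc k)))) = refl
  expand (suc n) zero                      = refl
  expand (suc n) (suc k)                   = expand n k

sumℤ : List ℤ → ℤ
sumℤ = List.foldr ℤ._+_ 0ℤ

telescope : ∀ n (g : ℕ → ℤ) →
  sumℤ (tabulate {n = n} λ i → g (toℕ i) ℤ.- g (suc (toℕ i))) ≡ g 0 ℤ.- g n
telescope zero    g = sym (ℤ.+-inverseʳ (g 0))
telescope (suc n) g = trans
  (cong (ℤ._+_ (g 0 ℤ.- g 1)) (telescope n (g ∘ suc)))
  (cancel (g 0) (g 1) (g (suc n)))
  where
  cancel : ∀ x y z → x ℤ.- y ℤ.+ (y ℤ.- z) ≡ x ℤ.- z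
  cancel = ℤ-Solver.solve-∀






coeff-replicate-++-< : ∀ n p {k} → k < n → coeff (replicate n 0ℤ ++ p) k ≡ 0ℤ
coeff-replicate-++-< (suc n) p {zero}  k<n = refl
coeff-replicate-++-< (suc n) p {suc k} k<n = coeff-replicate-++-< n p (ℕ.≤-pred k<n)

coeff-replicate-++-+ : ∀ n p k → coeff (replicate n 0ℤ ++ p) (n + k) ≡ coeff p k
coeff-replicate-++-+ zero    p k = refl
coeff-replicate-++-+ (suc n) p k = coeff-replicate-++-+ n p k

sum-*D : ∀ ps k → coeff (sumₚ ps *ₚ D) k ≡ sumℤ (map (λ p → coeff (p *ₚ D) k) ps)
sum-*D []       k = refl
sum-*D (p ∷ ps) k = trans (*ₚ-distribʳ p (sumₚ ps) D k) 
  (cong (ℤ._+_ (coeff (p *ₚ D) k)) (sum-*D ps k))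

sumℤ-++ : ∀ xs ys → sumℤ (xs ++ ys) ≡ sumℤ xs ℤ.+ sumℤ ys
sumℤ-++ []       ys = sym (ℤ.+-identityˡ _)
sumℤ-++ (x ∷ xs) ys = trans (cong (ℤ._+_ x) (sumℤ-++ xs ys)) (sym (ℤ.+-assoc x _ _))

sumℤ-concat : ∀ xss → sumℤ (concat xss) ≡ sumℤ (map sumℤ xss)
sumℤ-concat []         = refl
sumℤ-concat (xs ∷ xss) = trans (sumℤ-++ xs (concat xss)) 
  (cong (ℤ._+_ (sumℤ xs)) (sumℤ-concat xss))

module GeneratingFunction (N T : ℕ) where

  exponents : ∀ t → List ℕ
  exponents t = concat (tabulate {n = t} λ c →
    tabulate {n = T ∸ toℕ c} λ k → toℕ k + (toℕ c * 2 + N))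

  module _ (x : ℕ) where

    δ g : ℕ → ℤ
    δ n = coeff (q^ n) x
    g c = δ (c * 2 + N) ℤ.- δ (c + (T + N)) ℤ.- δ (suc c + (T + N))

    -- Grouping `D` as (1 - q^2) - q(1 - q^2) makes each summand a difference of consecutive values,
    -- those of q^(k+e)(1 - q^2).
    inner : ∀ L e → sumℤ (tabulate {n = L} λ k → coeff (q^ (toℕ k + e) *ₚ D) x)
                  ≡ δ e ℤ.- δ (2 + e) ℤ.- (δ (L + e) ℤ.- δ (2 + (L + e)))
    inner L e = trans
      (cong sumℤ (List.tabulate-cong {n = L} λ k →
        trans (q^*D (toℕ k + e) x) (regroup (δ (toℕ k + e)) (δ (1 + (toℕ k + e)))
          (δ (2 + (toℕ k + e))) (δ (3 + (toℕ k + e))))))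
      (telescope L λ k → δ (k + e) ℤ.- δ (2 + (k + e)))
      where
      regroup : ∀ a b c d → a ℤ.- b ℤ.- (c ℤ.- d) ≡ a ℤ.- c ℤ.- (b ℤ.- d)
      regroup = ℤ-Solver.solve-∀

    -- For `c ≤ T` the truncated subtraction is genuine, so the inner sum stops at T - c + 2c + N =
    -- c + T + N. The power between `c + (T + N)` and `2 + (c + (T + N))` belongs to both `g c` and
    -- `g (suc c)` and cancels.
    step : ∀ c → c ≤ T →
      δ (c * 2 + N) ℤ.- δ (2 + (c * 2 + N))
        ℤ.- (δ (T ∸ c + (c * 2 + N)) ℤ.- δ (2 + (T ∸ c + (c * 2 + N))))
      ≡ g c ℤ.- g (suc c)
    step c c≤T = trans
      (cong (λ e → δ (c * 2 + N) ℤ.- δ (2 + (c * 2 + N)) ℤ.- (δ e ℤ.- δ (2 + e))) top)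
      (regroup (δ (c * 2 + N)) (δ (2 + (c * 2 + N))) (δ (c + (T + N)))
               (δ (1 + (c + (T + N)))) (δ (2 + (c + (T + N)))))
      where
      top : T ∸ c + (c * 2 + N) ≡ c + (T + N)
      top = begin
        T ∸ c + (c * 2 + N)       ≡⟨ ℕ.+-assoc (T ∸ c) _ N ⟨
        T ∸ c + c * 2 + N         ≡⟨ cong (λ d → T ∸ c + d + N) (ℕ.*-comm c 2) ⟩
        T ∸ c + (c + (c + 0)) + N ≡⟨ cong (λ d → T ∸ c + (c + d) + N) (ℕ.+-identityʳ c) ⟩
        T ∸ c + (c + c) + N       ≡⟨ cong (_+ N) (ℕ.+-assoc (T ∸ c) c c) ⟨
        T ∸ c + c + c + N         ≡⟨ cong (λ d → d + c + N) (ℕ.m∸n+n≡m c≤T) ⟩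
        T + c + N                 ≡⟨ cong (_+ N) (ℕ.+-comm T c) ⟩
        c + T + N                 ≡⟨ ℕ.+-assoc c T N ⟩
        c + (T + N)               ∎
        where open ≡-Reasoning
      regroup : ∀ a b u v w → a ℤ.- b ℤ.- (u ℤ.- w) ≡ a ℤ.- u ℤ.- v ℤ.- (b ℤ.- v ℤ.- w)
      regroup = ℤ-Solver.solve-∀

    coeff-sum : ∀ t → t ≤ suc T →
      coeff (sumₚ (map q^_ (exponents t)) *ₚ D) x ≡ g 0 ℤ.- g t
    coeff-sum t t≤ = begin
      coeff (sumₚ (map q^_ (exponents t)) *ₚ D) x
        ≡⟨ sum-*D (map q^_ (exponents t)) x ⟩
      sumℤ (map (λ p → coeff (p *ₚ D) x) (map q^_ (exponents t)))
        ≡⟨ cong sumℤ (List.map-∘ (exponents t)) ⟨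
      sumℤ (map F (concat (tabulate rows)))
        ≡⟨ cong sumℤ (List.concat-map (tabulate rows)) ⟨
      sumℤ (concat (map (map F) (tabulate rows)))
        ≡⟨ sumℤ-concat (map (map F) (tabulate rows)) ⟩
      sumℤ (map sumℤ (map (map F) (tabulate rows)))
        ≡⟨ cong (λ xss → sumℤ (map sumℤ xss)) (List.map-tabulate rows (map F)) ⟩
      sumℤ (map sumℤ (tabulate (map F ∘ rows)))
        ≡⟨ cong sumℤ (List.map-tabulate (map F ∘ rows) sumℤ) ⟩
      sumℤ (tabulate λ c → sumℤ (map F (rows c)))
        ≡⟨ cong sumℤ (List.tabulate-cong {n = t} λ c → trans
             (cong sumℤ (List.map-tabulate {n = T ∸ toℕ c} (λ k → toℕ k + (toℕ c * 2 + N)) F))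
             (trans (inner (T ∸ toℕ c) (toℕ c * 2 + N))
                    (step (toℕ c) (ℕ.≤-pred (ℕ.≤-trans (Fin.toℕ<n c) t≤))))) ⟩
      sumℤ (tabulate {n = t} λ c → g (toℕ c) ℤ.- g (suc (toℕ c)))
        ≡⟨ telescope t g ⟩
      g 0 ℤ.- g t ∎
      where
      open ≡-Reasoning
      F : ℕ → ℤ
      F n = coeff (q^ n *ₚ D) x
      rows : Fin t → List ℕ
      rows c = tabulate {n = T ∸ toℕ c} λ k → toℕ k + (toℕ c * 2 + N)

-- The numerator of the closed form

coeff-q^-< : ∀ n {x} → x < n → coeff (q^ n) x ≡ 0ℤ
coeff-q^-< n = coeff-replicate-++-< n 1ₚ

coeff-q^-+ : ∀ n j y → coeff (q^ (j + n)) (n + y) ≡ coeff (q^ j) y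
coeff-q^-+ n j y = trans (cong (λ e → coeff (q^ e) (n + y)) (ℕ.+-comm j n)) (go n)
  where
  go : ∀ n → coeff (q^ (n + j)) (n + y) ≡ coeff (q^ j) y
  go zero    = refl
  go (suc n) = go n

bracket : ℕ → ℕ → ℕ → ℕ → Poly
bracket a b c d = 1ₚ -ₚ q^ a -ₚ (+ 2) ·ₚ q^ b +ₚ q^ c +ₚ q^ d

coeff-bracket : ∀ a b c d y → coeff (bracket a b c d) y
  ≡ coeff (q^ 0) y ℤ.- coeff (q^ a) y ℤ.- + 2 ℤ.* coeff (q^ b) y
    ℤ.+ coeff (q^ c) y ℤ.+ coeff (q^ d) y
coeff-bracket a b c d y
  rewrite coeff-+ (1ₚ -ₚ q^ a -ₚ (+ 2) ·ₚ q^ b +ₚ q^ c) (q^ d) y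
        | coeff-+ (1ₚ -ₚ q^ a -ₚ (+ 2) ·ₚ q^ b) (q^ c) y
        | coeff-minus (1ₚ -ₚ q^ a) ((+ 2) ·ₚ q^ b) y
        | coeff-minus 1ₚ (q^ a) y
        | coeff-· (+ 2) (q^ b) y = refl

module _ (N T : ℕ) where
  open GeneratingFunction N T

  coeff-numerator : ∀ t x → t * 2 ≡ suc T →
    coeff (q^ N *ₚ bracket T (suc T) (t + T) (suc (t + T)) *ₚ 1ₚ) x
      ≡ g x 0 ℤ.- g x t
  coeff-numerator t x 2t≡1+T = begin
    coeff (q^ N *ₚ B *ₚ 1ₚ) x      ≡⟨ *ₚ-identityʳ (q^ N *ₚ B) x ⟩
    coeff (q^ N *ₚ B) x            ≡⟨ q^*-coeff N B x ⟩
    coeff (replicate N 0ℤ ++ B) x  ≡⟨ shifted x ⟩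
    target (δ x N) (δ x (T + N)) (δ x (suc T + N)) (δ x (t + T + N)) (δ x (suc (t + T) + N))
      ≡⟨ cong₂ (λ e f → target (δ x N) (δ x (T + N)) (δ x (e + N)) (δ x f) (δ x (suc f)))
               (sym 2t≡1+T) (ℕ.+-assoc t T N) ⟩
    target (δ x N) (δ x (T + N)) (δ x (t * 2 + N)) (δ x (t + (T + N))) (δ x (suc (t + (T + N))))
      -- `target` uses its third argument twice, as the power T + 1 in `g x 0` and as the power 2t
      -- in `g x t`. Both have become `t * 2`; only the former is turned back into `suc T`.
      ≡⟨ cong (λ e → δ x N ℤ.- δ x (T + N) ℤ.- δ x (e + N)
                 ℤ.- (δ x (t * 2 + N) ℤ.- δ x (t + (T + N)) ℤ.- δ x (suc (t + (T + N))))) 2t≡1+T ⟩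
    g x 0 ℤ.- g x t                ∎
    where
    open ≡-Reasoning

    B = bracket T (suc T) (t + T) (suc (t + T))

    target : ℤ → ℤ → ℤ → ℤ → ℤ → ℤ
    target o a b c d = o ℤ.- a ℤ.- b ℤ.- (b ℤ.- c ℤ.- d)

    regroup : ∀ o a b c d →
      o ℤ.- a ℤ.- + 2 ℤ.* b ℤ.+ c ℤ.+ d ≡ o ℤ.- a ℤ.- b ℤ.- (b ℤ.- c ℤ.- d)
    regroup = ℤ-Solver.solve-∀

    shifted : ∀ x → coeff (replicate N 0ℤ ++ B) x
      ≡ target (δ x N) (δ x (T + N)) (δ x (suc T + N)) (δ x (t + T + N)) (δ x (suc (t + T) + N))
    shifted x with x ℕ.<? N
    ... | yes x<N
      rewrite coeff-replicate-++-< N B x<N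
            | coeff-q^-< N x<N
            | coeff-q^-< (T + N) (ℕ.<-≤-trans x<N (ℕ.m≤n+m N T))
            | coeff-q^-< (suc T + N) (ℕ.<-≤-trans x<N (ℕ.m≤n+m N (suc T)))
            | coeff-q^-< (t + T + N) (ℕ.<-≤-trans x<N (ℕ.m≤n+m N (t + T)))
            | coeff-q^-< (suc (t + T) + N) (ℕ.<-≤-trans x<N (ℕ.m≤n+m N (suc (t + T)))) = refl
    ... | no x≮N
      rewrite sym (ℕ.m+[n∸m]≡n (ℕ.≮⇒≥ x≮N))
            | coeff-replicate-++-+ N B (x ∸ N)
            | coeff-q^-+ N 0 (x ∸ N)
            | coeff-q^-+ N T (x ∸ N)
            | coeff-q^-+ N (suc T) (x ∸ N)
            | coeff-q^-+ N (t + T) (x ∸ N)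
            | coeff-q^-+ N (suc (t + T)) (x ∸ N)
            | coeff-bracket T (suc T) (t + T) (suc (t + T)) (x ∸ N) =
      regroup (coeff (q^ 0) (x ∸ N)) (coeff (q^ T) (x ∸ N)) (coeff (q^ suc T) (x ∸ N))
              (coeff (q^ (t + T)) (x ∸ N)) (coeff (q^ suc (t + T)) (x ∸ N))

-- Permutations and the positions of their letters

abstract
  -- If `y` were missed, punching it out of the codomain would leave an injection from `Fin (suc n)`
  -- to `Fin n`.
  injective⇒surjective : ∀ {n} (f : Fin n → Fin n) → Injective _≡_ _≡_ f →
                         ∀ y → ∃[ x ] f x ≡ y
  injective⇒surjective {suc n} f inj y with Fin.any? (λ x → f x Fin.≟ y)
  ... | yes found  = found
  ... | no  ∄preimage = contradiction
    (Fin.injective⇒≤ {f = λ x → punchOut (y≢f x)}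
      (inj ∘ Fin.punchOut-injective (y≢f _) (y≢f _)))
    ℕ.1+n≰n
    where
    y≢f : ∀ x → y ≢ f x
    y≢f x y≡fx = ∄preimage (x , sym y≡fx)

-- The inverse permutation. The poset relations and the forced order both compare the positions of
-- given letters, so the argument runs on `pos` and returns to words only at the end.
record Positions {n} (π : Word n n) : Set where
  field
    pos        : Fin n → Fin n
    lookup-pos : ∀ y → lookup π (pos y) ≡ y
    pos-lookup : ∀ i → pos (lookup π i) ≡ i

  pos-injective : ∀ {x y} → pos x ≡ pos y → x ≡ y
  pos-injective {x} {y} eq =
    trans (sym (lookup-pos x)) (trans (cong (lookup π) eq) (lookup-pos y))

  appearsBefore⁻ : ∀ {a b} → AppearsBefore π a b → pos a Fin.< pos b
  appearsBefore⁻ (i , j , refl , refl , i<j) =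
    subst₂ Fin._<_ (sym (pos-lookup i)) (sym (pos-lookup j)) i<j

  appearsBefore⁺ : ∀ {a b} → pos a Fin.< pos b → AppearsBefore π a b
  appearsBefore⁺ {a} {b} lt = pos a , pos b , lookup-pos a , lookup-pos b , lt

  isPermutation : IsPermutation π
  isPermutation = subst IsPermutation (Vec.tabulate∘lookup π)
    (VecUnique.tabulate⁺ λ {i} {j} eq →
      trans (sym (pos-lookup i)) (trans (cong pos eq) (pos-lookup j)))

open Positions

injective⇒positions : ∀ {n} (π : Word n n) → Injective _≡_ _≡_ (lookup π) → Positions π
injective⇒positions π inj = record
  { pos        = λ y → proj₁ (surj y)
  ; lookup-pos = λ y → proj₂ (surj y)
  ; pos-lookup = λ i → inj (proj₂ (surj (lookup π i)))
  }
  where surj = injective⇒surjective (lookup π) inj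

positions : ∀ {n} {π : Word n n} → IsPermutation π → Positions π
positions {π = π} perm = injective⇒positions π (lookup-injective perm _ _)

-- Occurrences of 1243 in terms of letters

pattern-1243 : Word 4 4
pattern-1243 = 0F ∷ 1F ∷ 3F ∷ 2F ∷ []

-- The letters x₁ x₂ x₃ x₄ are listed by position, so x₄ plays the 3 of the pattern.
Occurs1243 : ∀ {n} {π : Word n n} → Positions π → Set
Occurs1243 ρ = ∃[ x₁ ] ∃[ x₂ ] ∃[ x₃ ] ∃[ x₄ ]
  (x₁ Fin.< x₂ × x₂ Fin.< x₄ × x₄ Fin.< x₃ ×
   pos ρ x₁ Fin.< pos ρ x₂ × pos ρ x₂ Fin.< pos ρ x₃ × pos ρ x₃ Fin.< pos ρ x₄)

contains⁻ : ∀ {n} {π : Word n n} (ρ : Positions π) → Contains π pattern-1243 → Occurs1243 ρ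
contains⁻ {π = π} ρ (is , mono , iso) =
  x 0F , x 1F , x 2F , x 3F ,
  from (iso 0F 1F) (s≤s z≤n) ,
  from (iso 1F 3F) (s≤s (s≤s z≤n)) ,
  from (iso 3F 2F) (s≤s (s≤s (s≤s z≤n))) ,
  ordered 0F 1F (s≤s z≤n) ,
  ordered 1F 2F (s≤s (s≤s z≤n)) ,
  ordered 2F 3F (s≤s (s≤s (s≤s z≤n)))
  where
  open Equivalence
  x : Fin 4 → Fin _
  x j = lookup π (lookup is j)
  ordered : ∀ j l → j Fin.< l → pos ρ (x j) Fin.< pos ρ (x l)
  ordered j l j<l = subst₂ Fin._<_ (sym (pos-lookup ρ _)) (sym (pos-lookup ρ _)) (mono j l j<l)

chain-mono : ∀ {n} (u : Fin 4 → Fin n) → u 0F Fin.< u 1F → u 1F Fin.< u 2F → u 2F Fin.< u 3F →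
             ∀ j l → j Fin.< l → u j Fin.< u l
chain-mono u p q r 0F 1F _ = p
chain-mono u p q r 0F 2F _ = ℕ.<-trans p q
chain-mono u p q r 0F 3F _ = ℕ.<-trans p (ℕ.<-trans q r)
chain-mono u p q r 1F 2F _ = q
chain-mono u p q r 1F 3F _ = ℕ.<-trans q r
chain-mono u p q r 2F 3F _ = r
chain-mono u p q r 1F 1F (s≤s ())
chain-mono u p q r 2F 1F (s≤s ())
chain-mono u p q r 2F 2F (s≤s (s≤s ()))
chain-mono u p q r 3F 1F (s≤s ())
chain-mono u p q r 3F 2F (s≤s (s≤s ()))
chain-mono u p q r 3F 3F (s≤s (s≤s (s≤s ())))

mono⇒reflecting : ∀ {m n} (u : Fin m → Fin n) → (∀ j l → j Fin.< l → u j Fin.< u l) →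
                  ∀ j l → u j Fin.< u l → j Fin.< l
mono⇒reflecting u mono j l lt with Fin.<-cmp j l
... | tri< j<l _ _ = j<l
... | tri≈ _ refl _ = contradiction lt (ℕ.<-irrefl refl)
... | tri> _ _ j>l = contradiction (mono l j j>l) (ℕ.<-asym lt)

contains⁺ : ∀ {n} {π : Word n n} (ρ : Positions π) → Occurs1243 ρ → Contains π pattern-1243
contains⁺ {n} {π} ρ (x₁ , x₂ , x₃ , x₄ , x₁<x₂ , x₂<x₄ , x₄<x₃ , p₁<p₂ , p₂<p₃ , p₃<p₄) =
  is , chain-mono (lookup is) p₁<p₂ p₂<p₃ p₃<p₄ , iso
  where
  is : Vec (Fin n) 4
  is = pos ρ x₁ ∷ pos ρ x₂ ∷ pos ρ x₃ ∷ pos ρ x₄ ∷ []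
  -- The four letters in increasing order, hence `x₄` before `x₃`. Both sides of `iso` then compare
  -- arguments of one increasing map.
  byValue : Fin 4 → Fin n
  byValue = lookup (x₁ ∷ x₂ ∷ x₄ ∷ x₃ ∷ [])
  value : ∀ j → lookup π (lookup is j) ≡ byValue (lookup pattern-1243 j)
  value 0F = lookup-pos ρ x₁
  value 1F = lookup-pos ρ x₂
  value 2F = lookup-pos ρ x₃
  value 3F = lookup-pos ρ x₄
  mono : ∀ j l → j Fin.< l → byValue j Fin.< byValue l
  mono = chain-mono byValue x₁<x₂ x₂<x₄ x₄<x₃
  iso : ∀ j l → lookup π (lookup is j) Fin.< lookup π (lookup is l)
              ⇔ lookup pattern-1243 j Fin.< lookup pattern-1243 l
  iso j l rewrite value j | value l = mk⇔ (mono⇒reflecting byValue mono _ _) (mono _ _)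

-- Counting inversions by their smaller letter

indicator : ∀ {P : Set} → Dec P → ℕ
indicator P? = if does P? then 1 else 0

indicator-true : ∀ {P : Set} (P? : Dec P) → P → indicator P? ≡ 1
indicator-true P? p = cong (if_then 1 else 0) (dec-true P? p)

indicator-false : ∀ {P : Set} (P? : Dec P) → ¬ P → indicator P? ≡ 0
indicator-false P? ¬p = cong (if_then 1 else 0) (dec-false P? ¬p)

indicator-⇔ : ∀ {P Q : Set} (P? : Dec P) (Q? : Dec Q) → (P → Q) → (Q → P) →
              indicator P? ≡ indicator Q?
indicator-⇔ P? (yes q) to from = indicator-true P? (from q)
indicator-⇔ P? (no ¬q) to from = indicator-false P? (¬q ∘ to)

length-filter-map-tabulate : ∀ {A B : Set} {P : Pred B 0ℓ} (P? : Decidable P) (f : A → B)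
  {n} (g : Fin n → A) →
  length (filter P? (List.map f (tabulate g))) ≡ ∑[ i < n ] indicator (P? (f (g i)))
length-filter-map-tabulate P? f {zero}  g = refl
length-filter-map-tabulate P? f {suc n} g with does (P? (f (g zero)))
... | true  = cong suc (length-filter-map-tabulate P? f (g ∘ suc))
... | false = length-filter-map-tabulate P? f (g ∘ suc)

length-filter-cartesianProduct : ∀ {A B : Set} {P : Pred (A × B) 0ℓ} (P? : Decidable P)
  {m n} (g : Fin m → A) (h : Fin n → B) →
  length (filter P? (cartesianProduct (tabulate g) (tabulate h)))
    ≡ ∑[ i < m ] ∑[ j < n ] indicator (P? (g i , h j))
length-filter-cartesianProduct P? {zero}  g h = refl
length-filter-cartesianProduct P? {suc m} g h = begin
  length (filter P? (firstRow ++ otherRows))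
    ≡⟨ cong length (List.filter-++ P? firstRow otherRows) ⟩
  length (filter P? firstRow ++ filter P? otherRows)
    ≡⟨ List.length-++ (filter P? firstRow) ⟩
  length (filter P? firstRow) + length (filter P? otherRows)
    ≡⟨ cong₂ _+_ (length-filter-map-tabulate P? (g zero ,_) h)
                 (length-filter-cartesianProduct P? (g ∘ suc) h) ⟩
  sum (λ i → sum (λ j → indicator (P? (g i , h j)))) ∎
  where
  open ≡-Reasoning
  firstRow  = List.map (g zero ,_) (tabulate h)
  otherRows = cartesianProduct (tabulate (g ∘ suc)) (tabulate h)

module _ {n} {π : Word n n} (ρ : Positions π) where

  sum-pos : ∀ (f : Fin n → ℕ) → sum f ≡ ∑[ y < n ] f (pos ρ y)
  sum-pos f = sum-permute f (permutation (pos ρ) (lookup π) (pos-lookup ρ) (lookup-pos ρ))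

  inversion? : ∀ y x → Dec (pos ρ x Fin.< pos ρ y × y Fin.< x)
  inversion? y x = (pos ρ x Fin.<? pos ρ y) ×-dec (y Fin.<? x)

  inversionsAt : Fin n → ℕ
  inversionsAt y = ∑[ x < n ] indicator (inversion? y x)

  -- The later position of an inversion holds the smaller letter, so the sum over later positions is
  -- moved outside; both sums are then reindexed from positions to letters.
  inv-sum : inv π ≡ ∑[ y < n ] inversionsAt y
  inv-sum = begin
    inv π
      ≡⟨ length-filter-cartesianProduct (λ (i , j) → inv? i j) (λ i → i) (λ j → j) ⟩
    ∑[ i < n ] ∑[ j < n ] indicator (inv? i j)
      ≡⟨ ∑-comm (λ i j → indicator (inv? i j)) ⟩
    ∑[ j < n ] ∑[ i < n ] indicator (inv? i j)
      ≡⟨ sum-pos (λ j → ∑[ i < n ] indicator (inv? i j)) ⟩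
    ∑[ y < n ] ∑[ i < n ] indicator (inv? i (pos ρ y))
      ≡⟨ sum-cong-≗ (λ y → sum-pos (λ i → indicator (inv? i (pos ρ y)))) ⟩
    ∑[ y < n ] ∑[ x < n ] indicator (inv? (pos ρ x) (pos ρ y))
      ≡⟨ sum-cong-≗ (λ y → sum-cong-≗ (λ x → indicator-⇔ (inv? (pos ρ x) (pos ρ y)) (inversion? y x)
           (λ (p , q) → p , subst₂ Fin._<_ (lookup-pos ρ y) (lookup-pos ρ x) q)
           (λ (p , q) → p , subst₂ Fin._<_ (sym (lookup-pos ρ y)) (sym (lookup-pos ρ x)) q))) ⟩
    ∑[ y < n ] inversionsAt y ∎
    where
    open ≡-Reasoning
    inv? : ∀ i j → Dec (i Fin.< j × lookup π j Fin.< lookup π i)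
    inv? i j = (i Fin.<? j) ×-dec (lookup π j Fin.<? lookup π i)

sum-+ : ∀ m {n} (f : Fin (m + n) → ℕ) →
        sum f ≡ ∑[ i < m ] f (i ↑ˡ n) + ∑[ j < n ] f (m ↑ʳ j)
sum-+ zero    f = refl
sum-+ (suc m) f = trans (cong (λ e → f zero + e) (sum-+ m (f ∘ suc))) (sym (ℕ.+-assoc (f zero) _ _))

sum-combine : ∀ m {n} (f : Fin (m * n) → ℕ) →
              sum f ≡ ∑[ i < m ] ∑[ j < n ] f (combine i j)
sum-combine zero        f = refl
sum-combine (suc m) {n} f = trans (sum-+ n f)
  (cong (λ e → sum (λ j → f (j ↑ˡ (m * n))) + e) (sum-combine m (f ∘ (n ↑ʳ_))))

sum-const : ∀ n c → ∑[ i < n ] c ≡ n * c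
sum-const zero    c = refl
sum-const (suc n) c = cong (λ e → c + e) (sum-const n c)

count-< : ∀ {n} a → a ≤ n → ∑[ i < n ] indicator (toℕ i ℕ.<? a) ≡ a
count-< {n}     zero    a≤n       = sum-replicate-zero n
count-< {suc n} (suc a) (s≤s a≤n) = cong suc (trans
  (sum-cong-≗ {n} (λ i → indicator-⇔ (suc (toℕ i) ℕ.<? suc a) (toℕ i ℕ.<? a) ℕ.≤-pred s≤s))
  (count-< a a≤n))

-- Increasing functions

-- Fin.punchIn on ℕ: the increasing enumeration of the numbers other than p
skip : ℕ → ℕ → ℕ
skip zero    x       = suc x
skip (suc p) zero    = zero
skip (suc p) (suc x) = suc (skip p x)

skip-mono-< : ∀ p {x y} → x < y → skip p x < skip p y
skip-mono-< zero    x<y                     = s≤s x<y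
skip-mono-< (suc p) {zero}  {suc y} x<y       = s≤s z≤n
skip-mono-< (suc p) {suc x} {suc y} (s≤s x<y) = s≤s (skip-mono-< p x<y)

skip-cancel-< : ∀ p {x y} → skip p x < skip p y → x < y
skip-cancel-< p {x} {y} lt with ℕ.<-cmp x y
... | tri< x<y _ _  = x<y
... | tri≈ _ refl _ = contradiction lt (ℕ.<-irrefl refl)
... | tri> _ _ x>y  = contradiction (skip-mono-< p x>y) (ℕ.<-asym lt)

skip-< : ∀ {p x} → x < p → skip p x ≡ x
skip-< {suc p} {zero}  x<p       = refl
skip-< {suc p} {suc x} (s≤s x<p) = cong suc (skip-< x<p)

skip-≥ : ∀ {p x} → p ≤ x → skip p x ≡ suc x
skip-≥ z≤n       = refl
skip-≥ (s≤s p≤x) = cong suc (skip-≥ p≤x)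

x≤skip : ∀ p x → x ≤ skip p x
x≤skip zero    x       = ℕ.n≤1+n x
x≤skip (suc p) zero    = z≤n
x≤skip (suc p) (suc x) = s≤s (x≤skip p x)

skip≤1+x : ∀ p x → skip p x ≤ suc x
skip≤1+x zero    x       = ℕ.≤-refl
skip≤1+x (suc p) zero    = z≤n
skip≤1+x (suc p) (suc x) = s≤s (skip≤1+x p x)

unskip : ∀ p {y} → y ≢ p → ∃[ x ] skip p x ≡ y
unskip zero    {zero}  y≢p = contradiction refl y≢p
unskip zero    {suc y} y≢p = y , refl
unskip (suc p) {zero}  y≢p = zero , refl
unskip (suc p) {suc y} y≢p with x , eq ← unskip p (y≢p ∘ cong suc) = suc x , cong suc eq

-- The value `p` takes up one of the first `suc M` numbers, which leaves `M` of them for `skip p`: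
-- an `x ≥ M` would be at least `p` and move up to `suc x`.
skip-cancel-bound : ∀ {p x M} → p ≤ M → skip p x < suc M → x < M
skip-cancel-bound {p} {x} {M} p≤M lt with x ℕ.<? M
... | yes x<M = x<M
... | no  x≮M = contradiction (subst (_< suc M) (skip-≥ (ℕ.≤-trans p≤M (ℕ.≮⇒≥ x≮M))) lt)
                              (x≮M ∘ ℕ.≤-pred)

Increasing : ∀ {n} → (Fin n → ℕ) → Set
Increasing h = ∀ {j j′} → j Fin.< j′ → h j < h j′

increasing-from-steps : ∀ {n} (h : Fin n → ℕ) →
  (∀ j j′ → toℕ j′ ≡ suc (toℕ j) → h j < h j′) → Increasing h
increasing-from-steps h step {zero}  {suc zero}     j<j′ = step _ _ refl
increasing-from-steps h step {zero}  {suc (suc j′)} j<j′ =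
  ℕ.<-trans (step zero (suc zero) refl)
            (increasing-from-steps (h ∘ suc) (λ i i′ → step _ _ ∘ cong suc) (s≤s z≤n))
increasing-from-steps h step {suc j} {suc j′} (s≤s j<j′) =
  increasing-from-steps (h ∘ suc) (λ i i′ → step _ _ ∘ cong suc) j<j′

increasing-cancel-< : ∀ {n} (h : Fin n → ℕ) → Increasing h →
                      ∀ {j j′} → h j < h j′ → j Fin.< j′
increasing-cancel-< h inc {j} {j′} lt with Fin.<-cmp j j′
... | tri< j<j′ _ _ = j<j′
... | tri≈ _ refl _ = contradiction lt (ℕ.<-irrefl refl)
... | tri> _ _ j>j′ = contradiction (inc j>j′) (ℕ.<-asym lt)

increasing-≤ : ∀ {n} (h : Fin n → ℕ) → Increasing h → ∀ {j j′} → j Fin.≤ j′ → h j ≤ h j′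
increasing-≤ h inc {j} {j′} j≤j′ with Fin.<-cmp j j′
... | tri< j<j′ _ _ = ℕ.<⇒≤ (inc j<j′)
... | tri≈ _ refl _ = ℕ.≤-refl
... | tri> _ _ j>j′ = contradiction j≤j′ (ℕ.<⇒≱ j>j′)

increasing-join : ∀ {m n} (h : Fin m → ℕ) (h′ : Fin n → ℕ) → Increasing h → Increasing h′ →
                  (∀ i j → h i < h′ j) → Increasing ([ h , h′ ]′ ∘ splitAt m)
increasing-join {zero}  h h′ inc inc′ h<h′ lt = inc′ lt
increasing-join {suc m} h h′ inc inc′ h<h′ {zero} {suc j′} lt with splitAt m j′
... | inj₁ i = inc (s≤s z≤n)
... | inj₂ i = h<h′ zero i
increasing-join {suc m} h h′ inc inc′ h<h′ {suc j} {suc j′} (s≤s lt)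
  rewrite [,]-map {f = suc} {g = id} {f′ = h} {g′ = h′} (splitAt m j)
        | [,]-map {f = suc} {g = id} {f′ = h} {g′ = h′} (splitAt m j′) =
  increasing-join (h ∘ suc) h′ (inc ∘ s≤s) inc′ (h<h′ ∘ suc) lt

increasing-lower : ∀ {n} (h : Fin n → ℕ) c → Increasing h → (∀ i → c ≤ h i) →
                   ∀ i → c + toℕ i ≤ h i
increasing-lower h c inc c≤h zero    = subst (_≤ h zero) (sym (ℕ.+-identityʳ c)) (c≤h zero)
increasing-lower h c inc c≤h (suc i) = subst (_≤ h (suc i)) (sym (ℕ.+-suc c (toℕ i)))
  (increasing-lower (h ∘ suc) (suc c) (inc ∘ s≤s)
    (λ j → ℕ.≤-<-trans (c≤h zero) (inc (s≤s z≤n))) i)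

-- There are as many values as places, so there is no slack: a first value above `c` would push the
-- last one beyond the bound. Once the first value is `c`, the others are treated in the same way
-- from `suc c`.
increasing-onto : ∀ {n} (h : Fin n → ℕ) c → Increasing h → (∀ i → c ≤ h i) → (∀ i → h i < c + n) →
                  ∀ i → h i ≡ c + toℕ i
increasing-onto {suc n} h c inc c≤h h<c+n = go
  where
  open ℕ.≤-Reasoning
  h₀≡c : h zero ≡ c
  h₀≡c with h zero ℕ.≟ c
  ... | yes eq = eq
  ... | no  ne = contradiction (begin-strict
      c + n                     <⟨ ℕ.n<1+n _ ⟩
      suc c + n                 ≡⟨ cong (λ e → suc c + e) (Fin.toℕ-fromℕ n) ⟨
      suc c + toℕ (fromℕ n)     ≤⟨ increasing-lower h (suc c) inc c<h (fromℕ n) ⟩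
      h (fromℕ n)               ≤⟨ ℕ.≤-pred (subst (h (fromℕ n) <_) (ℕ.+-suc c n) (h<c+n (fromℕ n))) ⟩
      c + n                     ∎) (ℕ.<-irrefl refl)
    where
    c<h : ∀ i → c < h i
    c<h i = ℕ.<-≤-trans (ℕ.≤∧≢⇒< (c≤h zero) (ne ∘ sym)) (increasing-≤ h inc (z≤n {toℕ i}))
  go : ∀ i → h i ≡ c + toℕ i
  go zero    = trans h₀≡c (sym (ℕ.+-identityʳ c))
  go (suc i) = trans
    (increasing-onto (h ∘ suc) (suc c) (inc ∘ s≤s)
      (λ j → ℕ.≤-<-trans (c≤h zero) (inc (s≤s z≤n)))
      (λ j → subst (h (suc j) <_) (ℕ.+-suc c n) (h<c+n (suc j))) i)
    (sym (ℕ.+-suc c (toℕ i)))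

combine-monoʳ-< : ∀ {s t} (r : Fin s) {j j′ : Fin t} → j Fin.< j′ → combine r j Fin.< combine r j′
combine-monoʳ-< {t = t} r {j} {j′} j<j′ =
  subst₂ _<_ (sym (Fin.toℕ-combine r j)) (sym (Fin.toℕ-combine r j′)) (ℕ.+-monoʳ-< (t * toℕ r) j<j′)

combine-cancel-< : ∀ {s t} (r r′ : Fin s) (j j′ : Fin t) → combine r j Fin.< combine r′ j′ →
                   r Fin.< r′ ⊎ (r ≡ r′ × j Fin.< j′)
combine-cancel-< r r′ j j′ lt with Fin.<-cmp r r′ | Fin.<-cmp j j′
... | tri< r<r′ _ _ | _              = inj₁ r<r′
... | tri≈ _ refl _ | tri< j<j′ _ _  = inj₂ (refl , j<j′)
... | tri≈ _ refl _ | tri≈ _ refl _  = contradiction lt (ℕ.<-irrefl refl)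
... | tri≈ _ refl _ | tri> _ _ j>j′  = contradiction (combine-monoʳ-< r j>j′) (ℕ.<-asym lt)
... | tri> _ _ r>r′ | _              = contradiction (Fin.combine-monoˡ-< j′ j r>r′) (ℕ.<-asym lt)

-- The order forced by avoidance

module _ {m : ℕ} where

  -- P r j is the position of cell j of row r; rows 2, 1, 0 are A, B, C.
  record Ordered (P : Fin 3 → Fin (suc m) → ℕ) : Set where
    field
      rows  : ∀ r → Increasing (P r)
      a₀<b₀ : P 2F zero < P 1F zero
      b₀<c₀ : P 1F zero < P 0F zero
      a<b   : ∀ j j′ → P 2F j < P 1F (suc j′)
      b<c   : ∀ j j′ → P 1F j < P 0F (suc j′)

    b₀≤b : ∀ j → P 1F zero ≤ P 1F j
    b₀≤b j = increasing-≤ (P 1F) (rows 1F) (z≤n {toℕ j})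

    b₀<c : ∀ j → P 1F zero < P 0F j
    b₀<c j = ℕ.<-≤-trans b₀<c₀ (increasing-≤ (P 0F) (rows 0F) (z≤n {toℕ j}))

    a<c : ∀ j j′ → P 2F j < P 0F (suc j′)
    a<c j j′ = ℕ.<-trans (a<b j j′) (b<c (suc j′) j′)

  open Ordered

  Lex : Fin 3 → Fin (suc m) → Fin 3 → Fin (suc m) → Set
  Lex r j r′ j′ = r Fin.< r′ ⊎ (r ≡ r′ × j Fin.< j′)

  -- The letters `x₃` and `x₄` descend, so they lie in different rows, and `x₂` belongs to a row of
  -- smaller labels than that of `x₃` although it comes before `x₃`. Only B₀ and C₀ can do so. No
  -- label is smaller than C₀, and the labels smaller than B₀ are the C's, which all come after it,
  -- so nothing is left for `x₁`.
  ordered-avoids : ∀ {P} → Ordered P → ∀ r₁ j₁ r₂ j₂ r₃ j₃ r₄ j₄ →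
    Lex r₁ j₁ r₂ j₂ → Lex r₂ j₂ r₄ j₄ → Lex r₄ j₄ r₃ j₃ →
    P r₁ j₁ < P r₂ j₂ → P r₂ j₂ < P r₃ j₃ → ¬ (P r₃ j₃ < P r₄ j₄)
  ordered-avoids ord _ _ _ _ r _ _ _ _ _ (inj₂ (refl , j₄<j₃)) _ _ p₃<p₄ =
    ℕ.<-asym p₃<p₄ (rows ord r j₄<j₃)
  ordered-avoids ord _ _ 0F (suc j₂) 1F j₃ _ _ _ _ (inj₁ _) _ p₂<p₃ _ = ℕ.<-asym p₂<p₃ (b<c ord j₃ j₂)
  ordered-avoids ord _ _ 0F (suc j₂) 2F j₃ _ _ _ _ (inj₁ _) _ p₂<p₃ _ = ℕ.<-asym p₂<p₃ (a<c ord j₃ j₂)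
  ordered-avoids ord 0F j₁ 1F zero _ _ _ _ (inj₁ _) _ (inj₁ _) p₁<p₂ _ _ = ℕ.<-asym p₁<p₂ (b₀<c ord j₁)
  ordered-avoids ord _ _ 1F (suc j₂) 2F j₃ _ _ _ _ (inj₁ _) _ p₂<p₃ _ = ℕ.<-asym p₂<p₃ (a<b ord j₃ j₂)
  -- The remaining clauses contradict the order of the labels alone.
  ordered-avoids ord _ _ 0F zero _ _ _ _ (inj₁ ()) _ _ _ _ _
  ordered-avoids ord _ _ 0F zero _ _ _ _ (inj₂ (_ , ())) _ _ _ _ _
  ordered-avoids ord _ _ 1F zero _ _ _ _ (inj₂ (_ , ())) _ _ _ _ _
  ordered-avoids ord 1F _ 1F zero _ _ _ _ (inj₁ (s≤s ())) _ _ _ _ _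
  ordered-avoids ord 2F _ 1F zero _ _ _ _ (inj₁ (s≤s ())) _ _ _ _ _
  ordered-avoids ord _ _ _ _ 0F _ _ _ _ _ (inj₁ ()) _ _ _
  ordered-avoids ord _ _ 1F (suc _) 1F _ 0F _ _ (inj₁ ()) _ _ _ _
  ordered-avoids ord _ _ 1F (suc _) 1F _ 0F _ _ (inj₂ (() , _)) _ _ _ _
  ordered-avoids ord _ _ 1F _ 1F _ (suc _) _ _ _ (inj₁ (s≤s ())) _ _ _
  ordered-avoids ord _ _ 2F _ _ _ 0F _ _ (inj₁ ()) _ _ _ _
  ordered-avoids ord _ _ 2F _ _ _ 1F _ _ (inj₁ (s≤s ())) _ _ _ _
  ordered-avoids ord _ _ 2F _ _ _ 2F _ _ (inj₁ (s≤s (s≤s ()))) _ _ _ _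
  ordered-avoids ord _ _ 2F _ 1F _ 2F _ _ _ (inj₁ (s≤s ())) _ _ _
  ordered-avoids ord _ _ 2F _ 2F _ 2F _ _ _ (inj₁ (s≤s (s≤s ()))) _ _ _

  module _ {π : Word (3 * suc m) (3 * suc m)} (ρ : Positions π) where

    posAt : Fin 3 → Fin (suc m) → ℕ
    posAt r j = toℕ (pos ρ (combine r j))

    ordered⇒generator : Ordered posAt → ∀ {x y} → Generator 3 (suc m) x y → pos ρ x Fin.< pos ρ y
    ordered⇒generator ord (row r j j′ eq)           = rows ord r (ℕ.≤-reflexive (sym eq))
    ordered⇒generator ord (col 0F 1F zero refl)     = b₀<c₀ ord
    ordered⇒generator ord (col 0F 1F (suc j) refl)  = b<c ord (suc j) j
    ordered⇒generator ord (col 1F 2F zero refl)     = a₀<b₀ ord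
    ordered⇒generator ord (col 1F 2F (suc j) refl)  = a<b ord (suc j) j

    ordered⇒less : Ordered posAt → ∀ {x y} → LessEN 3 (suc m) x y → pos ρ x Fin.< pos ρ y
    ordered⇒less ord [ g ]⁺    = ordered⇒generator ord g
    ordered⇒less ord (g ∷⁺ gs) = ℕ.<-trans (ordered⇒generator ord g) (ordered⇒less ord gs)

    ordered⇒isLinearExtension : Ordered posAt → IsLinearExtension 3 (suc m) π
    ordered⇒isLinearExtension ord = isPermutation ρ , λ _ _ → appearsBefore⁺ ρ ∘ ordered⇒less ord

    ordered⇒¬occurs : Ordered posAt → ¬ Occurs1243 ρ
    ordered⇒¬occurs ord (x₁ , x₂ , x₃ , x₄ , x₁<x₂ , x₂<x₄ , x₄<x₃ , p₁<p₂ , p₂<p₃ , p₃<p₄)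
      with r₁ , j₁ , refl ← Fin.combine-surjective {3} {suc m} x₁
         | r₂ , j₂ , refl ← Fin.combine-surjective {3} {suc m} x₂
         | r₃ , j₃ , refl ← Fin.combine-surjective {3} {suc m} x₃
         | r₄ , j₄ , refl ← Fin.combine-surjective {3} {suc m} x₄ =
      ordered-avoids ord r₁ j₁ r₂ j₂ r₃ j₃ r₄ j₄
        (combine-cancel-< r₁ r₂ j₁ j₂ x₁<x₂) (combine-cancel-< r₂ r₄ j₂ j₄ x₂<x₄)
        (combine-cancel-< r₄ r₃ j₄ j₃ x₄<x₃) p₁<p₂ p₂<p₃ p₃<p₄

    module _ (le : ∀ a b → LessEN 3 (suc m) a b → AppearsBefore π a b) where

      posAt-rows : ∀ r → Increasing (posAt r)
      posAt-rows r = increasing-from-steps (posAt r) λ j j′ eq →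
        appearsBefore⁻ ρ (le _ _ [ row r j j′ eq ]⁺)

      posAt-cols : ∀ r r′ j → toℕ r′ ≡ suc (toℕ r) → posAt r′ j < posAt r j
      posAt-cols r r′ j eq = appearsBefore⁻ ρ (le _ _ [ col r r′ j eq ]⁺)

      -- If (r′ , j) came after (r , j′ + 1), it would be the 4 in an occurrence
      -- whose 1, 2, 3 are the first, the (j′ + 1)st and the last cell of row r.
      avoids⇒separated : ¬ Occurs1243 ρ → ∀ r r′ j j′ → toℕ r′ ≡ suc (toℕ r) →
                         posAt r′ j < posAt r (suc j′)
      avoids⇒separated ¬occurs r r′ j j′ eq
        with ℕ.<-cmp (posAt r′ j) (posAt r (suc j′))
      ... | tri< lt _ _ = lt
      ... | tri≈ _ same _ = contradiction
        (Fin.combine-injectiveˡ r′ j r (suc j′) (pos-injective ρ (Fin.toℕ-injective same)))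
        (λ r′≡r → ℕ.1+n≢n (trans (sym eq) (cong toℕ r′≡r)))
      ... | tri> _ _ gt = contradiction
        ( combine r zero , combine r (suc j′) , combine r′ j , combine r last
        , combine-monoʳ-< r (s≤s z≤n)
        -- The occurrence needs column `suc j′` to differ from the last one. This is read off the
        -- positions: `(r , suc j′)` precedes `(r′ , j)`, which precedes the last cell of row `r`.
        , combine-monoʳ-< r
            (increasing-cancel-< (posAt r) (posAt-rows r) (ℕ.<-trans gt before-last))
        , Fin.combine-monoˡ-< last j (ℕ.≤-reflexive (sym eq))
        , posAt-rows r (s≤s z≤n) , gt , before-last)
        ¬occurs
        where
        last = fromℕ m
        before-last : posAt r′ j < posAt r last
        before-last = ℕ.≤-<-trans
          (increasing-≤ (posAt r′) (posAt-rows r′) (Fin.≤fromℕ j))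
          (posAt-cols r r′ last eq)

      avoids⇒ordered : ¬ Occurs1243 ρ → Ordered posAt
      avoids⇒ordered ¬occurs = record
        { rows  = posAt-rows
        ; a₀<b₀ = posAt-cols 1F 2F zero refl
        ; b₀<c₀ = posAt-cols 0F 1F zero refl
        ; a<b   = λ j j′ → avoids⇒separated ¬occurs 1F 2F j j′ refl
        ; b<c   = λ j j′ → avoids⇒separated ¬occurs 0F 1F j j′ refl
        }

-- Arrangements given by the positions of B₀ and C₀

module _ {m : ℕ} where
  open Ordered

  -- For a < p this enumerates in increasing order the positions other than `a` and `p`. The inner
  -- `skip` misses `a`, and the outer one misses `p` and fixes everything below `p`, so `a` stays
  -- missed.
  slot : ℕ → ℕ → ℕ → ℕ
  slot a p k = skip p (skip a k)

  -- The letters in forced order are numbered consecutively: `suc m` A's, then `m` B's, then `m`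
  -- C's.
  place : ℕ → ℕ → Fin 3 → Fin (suc m) → ℕ
  place a p 2F j       = slot a p (toℕ j)
  place a p 1F zero    = a
  place a p 1F (suc j) = slot a p (suc m + toℕ j)
  place a p 0F zero    = p
  place a p 0F (suc j) = slot a p (suc m + (m + toℕ j))

  2+slots≡n : suc (suc (suc m + (m + m))) ≡ 3 * suc m
  2+slots≡n = lemma m
    where
    lemma : ∀ m → suc (suc (suc m + (m + m))) ≡ 3 * suc m
    lemma = ℕ-Solver.solve-∀

  abstract
    -- This is what makes a word out of `place`: the cell found here is the one standing at position
    -- `i`. Undoing the two skips gives a number below `suc m + (m + m)`, and its block gives the
    -- row.
    place-surjective : ∀ {a p} → a < p → p < 3 * suc m → ∀ {i} → i < 3 * suc m →
                       ∃₂ λ r j → place a p r j ≡ i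
    place-surjective {a} {p} a<p p<n {i} i<n with i ℕ.≟ p
    ... | yes refl = 0F , zero , refl
    ... | no  i≢p with x , refl ← unskip p i≢p with x ℕ.≟ a
    ...   | yes refl = 1F , zero , sym (skip-< a<p)
    ...   | no  x≢a with k , refl ← unskip a x≢a = byBlock
      where
      p≤ : p ≤ suc (suc m + (m + m))
      p≤ = ℕ.≤-pred (subst (p <_) (sym 2+slots≡n) p<n)
      k< : k < suc m + (m + m)
      k< = skip-cancel-bound (ℕ.≤-pred (ℕ.≤-trans a<p p≤))
             (skip-cancel-bound p≤ (subst (slot a p k <_) (sym 2+slots≡n) i<n))
      inner : ∀ {k m} (k≥m : m ≤ k) {n} → k < m + n → k ∸ m < n
      inner {k} {m} k≥m {n} lt = ℕ.+-cancelˡ-< m _ _ (subst (_< m + n) (sym (ℕ.m+[n∸m]≡n k≥m)) lt)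
      byBlock : ∃₂ λ r j → place a p r j ≡ slot a p k
      byBlock with k ℕ.<? suc m
      ... | yes k<t = 2F , fromℕ< k<t , cong (slot a p) (Fin.toℕ-fromℕ< k<t)
      ... | no  k≮t with k ∸ suc m ℕ.<? m
      ...   | yes k<m = 1F , suc (fromℕ< k<m) , cong (slot a p)
                          (trans (cong (λ e → suc m + e) (Fin.toℕ-fromℕ< k<m)) (ℕ.m+[n∸m]≡n (ℕ.≮⇒≥ k≮t)))
      ...   | no  k≮m = 0F , suc (fromℕ< k<2m) , cong (slot a p) (begin
          suc m + (m + toℕ (fromℕ< k<2m)) ≡⟨ cong (λ e → suc m + (m + e)) (Fin.toℕ-fromℕ< k<2m) ⟩
          suc m + (m + (k ∸ suc m ∸ m))   ≡⟨ cong (λ e → suc m + e) (ℕ.m+[n∸m]≡n (ℕ.≮⇒≥ k≮m)) ⟩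
          suc m + (k ∸ suc m)             ≡⟨ ℕ.m+[n∸m]≡n (ℕ.≮⇒≥ k≮t) ⟩
          k                               ∎)
        where
        open ≡-Reasoning
        k<2m : k ∸ suc m ∸ m < m
        k<2m = inner (ℕ.≮⇒≥ k≮m) (inner (ℕ.≮⇒≥ k≮t) k<)

  slot-mono-< : ∀ a p {k l} → k < l → slot a p k < slot a p l
  slot-mono-< a p = skip-mono-< p ∘ skip-mono-< a

  -- The upper bounds keep B₀ before B₁ and C₀ before C₁. B₁ has number t in the forced order, so it
  -- is moved past `a` when a ≤ t; C₁ has number 2t - 1, which the skip over `a` raises to 2t and
  -- the skip over `p` to 2t + 1 when p ≤ 2t.
  place-ordered : ∀ {a p} → 0 < a → a ≤ suc m → a < p → p ≤ suc m + suc m → Ordered (place a p)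
  place-ordered {a} {p} 0<a a≤t a<p p≤2t = record
    { rows  = inc
    ; a₀<b₀ = subst (_< a) (sym slot₀) 0<a
    ; b₀<c₀ = a<p
    ; a<b   = λ j j′ → slot-mono-< a p (ℕ.<-≤-trans (Fin.toℕ<n j) (ℕ.m≤m+n (suc m) (toℕ j′)))
    ; b<c   = λ { zero j′ → b₀<slot (ℕ.≤-trans a≤t (ℕ.m≤m+n (suc m) _))
                ; (suc j) j′ → slot-mono-< a p (ℕ.+-monoʳ-< (suc m)
                    (ℕ.<-≤-trans (Fin.toℕ<n j) (ℕ.m≤m+n m (toℕ j′)))) }
    }
    where
    slot₀ : slot a p 0 ≡ 0
    slot₀ = trans (cong (skip p) (skip-< 0<a)) (skip-< (ℕ.<-trans 0<a a<p))

    b₀<slot : ∀ {k} → a ≤ k → a < slot a p k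
    b₀<slot {k} a≤k = ℕ.≤-trans (subst (suc a ≤_) (sym (skip-≥ a≤k)) (s≤s a≤k)) (x≤skip p (skip a k))

    c₀<slot : ∀ {k} → a ≤ k → p ≤ suc k → p < slot a p k
    c₀<slot {k} a≤k p≤1+k = subst (p <_)
      (sym (trans (cong (skip p) (skip-≥ a≤k)) (skip-≥ p≤1+k))) (s≤s p≤1+k)

    inc : ∀ r → Increasing (place a p r)
    inc 0F {zero}  {suc j′} _         = c₀<slot
      (ℕ.≤-trans a≤t (ℕ.m≤m+n (suc m) _))
      (ℕ.≤-trans p≤2t (ℕ.≤-trans (ℕ.≤-reflexive (ℕ.+-suc (suc m) m))
        (s≤s (ℕ.+-monoʳ-≤ (suc m) (ℕ.m≤m+n m (toℕ j′))))))
    inc 0F {suc j} {suc j′} (s≤s j<j′) = slot-mono-< a p (ℕ.+-monoʳ-< (suc m) (ℕ.+-monoʳ-< m j<j′))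
    inc 1F {zero}  {suc j′} _         = b₀<slot (ℕ.≤-trans a≤t (ℕ.m≤m+n (suc m) _))
    inc 1F {suc j} {suc j′} (s≤s j<j′) = slot-mono-< a p (ℕ.+-monoʳ-< (suc m) j<j′)
    inc 2F j<j′                        = slot-mono-< a p j<j′

  module _ {P : Fin 3 → Fin (suc m) → ℕ} (ord : Ordered P)
           (P-injective : ∀ {r j r′ j′} → P r j ≡ P r′ j′ → (r , j) ≡ (r′ , j′))
           (P<n : ∀ r j → P r j < 3 * suc m) where

    private
      a = P 1F zero
      p = P 0F zero

      slots : Fin (suc m + (m + m)) → ℕ
      slots = [ P 2F , [ P 1F ∘ suc , P 0F ∘ suc ]′ ∘ splitAt m ]′ ∘ splitAt (suc m)

      rest-increasing : Increasing ([ P 1F ∘ suc , P 0F ∘ suc ]′ ∘ splitAt m)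
      rest-increasing = increasing-join (P 1F ∘ suc) (P 0F ∘ suc)
        (rows ord 1F ∘ s≤s) (rows ord 0F ∘ s≤s) (b<c ord ∘ suc)

      slots-increasing : Increasing slots
      slots-increasing = increasing-join (P 2F) _ (rows ord 2F) rest-increasing below
        where
        below : ∀ i k → P 2F i < [ P 1F ∘ suc , P 0F ∘ suc ]′ (splitAt m k)
        below i k with splitAt m k
        ... | inj₁ j = a<b ord i j
        ... | inj₂ j = a<c ord i j

      other : ∀ {r j r′ j′} → (r , j) ≢ (r′ , j′) → P r j ≢ P r′ j′
      other ne = ne ∘ P-injective

      record NotSpecial (v : ℕ) : Set where
        field
          v≢a : v ≢ a
          v≢p : v ≢ p
          v<n : v < 3 * suc m
      open NotSpecial

      slots-not-special : ∀ k → NotSpecial (slots k)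
      slots-not-special k with splitAt (suc m) k
      ... | inj₁ j = record { v≢a = other λ () ; v≢p = other λ () ; v<n = P<n 2F j }
      ... | inj₂ k with splitAt m k
      ...   | inj₁ j = record { v≢a = other λ () ; v≢p = other λ () ; v<n = P<n 1F (suc j) }
      ...   | inj₂ j = record { v≢a = other λ () ; v≢p = other λ () ; v<n = P<n 0F (suc j) }

      p≤ : p ≤ suc (suc m + (m + m))
      p≤ = ℕ.≤-pred (subst (p <_) (sym 2+slots≡n) (P<n 0F zero))

      unslot : ∀ {v} → NotSpecial v → ∃[ k ] slot a p k ≡ v
      unslot s with x , refl ← unskip p (v≢p s)
        -- Since a < p, `skip p` fixes `a`; so `x ≡ a` would give the excluded value `a`.
        with k , refl ← unskip a {x} (λ { refl → v≢a s (skip-< (b₀<c₀ ord)) }) = k , refl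

      index : Fin (suc m + (m + m)) → ℕ
      index k = proj₁ (unslot (slots-not-special k))

      slot-index : ∀ k → slot a p (index k) ≡ slots k
      slot-index k = proj₂ (unslot (slots-not-special k))

      -- Once `a` and `p` are taken out of the range, the forced letters occupy 3t - 2 of the 3t - 2
      -- remaining places in increasing order, which leaves only the identity.
      index≡toℕ : ∀ k → index k ≡ toℕ k
      index≡toℕ = increasing-onto index 0
        (λ {k} {l} k<l → skip-cancel-< a (skip-cancel-< p
          (subst₂ _<_ (sym (slot-index k)) (sym (slot-index l)) (slots-increasing k<l))))
        (λ _ → z≤n)
        (λ k → skip-cancel-bound (ℕ.≤-pred (ℕ.≤-trans (b₀<c₀ ord) p≤))
          (skip-cancel-bound p≤ (subst₂ _<_ (sym (slot-index k)) (sym 2+slots≡n)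
            (v<n (slots-not-special k)))))

      slots≡ : ∀ k → slots k ≡ slot a p (toℕ k)
      slots≡ k = trans (sym (slot-index k)) (cong (slot a p) (index≡toℕ k))

    ordered⇒place : ∀ r j → P r j ≡ place a p r j
    ordered⇒place 2F j = begin
      P 2F j                          ≡⟨ cong [ P 2F , _ ]′ (Fin.splitAt-↑ˡ (suc m) j (m + m)) ⟨
      slots (j ↑ˡ (m + m))            ≡⟨ slots≡ (j ↑ˡ (m + m)) ⟩
      slot a p (toℕ (j ↑ˡ (m + m)))   ≡⟨ cong (slot a p) (Fin.toℕ-↑ˡ j (m + m)) ⟩
      slot a p (toℕ j)                ∎
      where open ≡-Reasoning
    ordered⇒place 1F zero = refl
    ordered⇒place 1F (suc j) = begin
      P 1F (suc j)                             ≡⟨ cong [ P 1F ∘ suc , P 0F ∘ suc ]′ (Fin.splitAt-↑ˡ m j m) ⟨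
      [ P 1F ∘ suc , P 0F ∘ suc ]′ (splitAt m (j ↑ˡ m))
        ≡⟨ cong [ P 2F , _ ]′ (Fin.splitAt-↑ʳ (suc m) (m + m) (j ↑ˡ m)) ⟨
      slots (suc m ↑ʳ (j ↑ˡ m))                ≡⟨ slots≡ (suc m ↑ʳ (j ↑ˡ m)) ⟩
      slot a p (toℕ (suc m ↑ʳ (j ↑ˡ m)))       ≡⟨ cong (slot a p) (Fin.toℕ-↑ʳ (suc m) (j ↑ˡ m)) ⟩
      slot a p (suc m + toℕ (j ↑ˡ m))          ≡⟨ cong (λ e → slot a p (suc m + e)) (Fin.toℕ-↑ˡ j m) ⟩
      slot a p (suc m + toℕ j)                 ∎
      where open ≡-Reasoning
    ordered⇒place 0F zero = refl
    ordered⇒place 0F (suc j) = begin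
      P 0F (suc j)                             ≡⟨ cong [ P 1F ∘ suc , P 0F ∘ suc ]′ (Fin.splitAt-↑ʳ m m j) ⟨
      [ P 1F ∘ suc , P 0F ∘ suc ]′ (splitAt m (m ↑ʳ j))
        ≡⟨ cong [ P 2F , _ ]′ (Fin.splitAt-↑ʳ (suc m) (m + m) (m ↑ʳ j)) ⟨
      slots (suc m ↑ʳ (m ↑ʳ j))                ≡⟨ slots≡ (suc m ↑ʳ (m ↑ʳ j)) ⟩
      slot a p (toℕ (suc m ↑ʳ (m ↑ʳ j)))       ≡⟨ cong (slot a p) (Fin.toℕ-↑ʳ (suc m) (m ↑ʳ j)) ⟩
      slot a p (suc m + toℕ (m ↑ʳ j))          ≡⟨ cong (λ e → slot a p (suc m + e)) (Fin.toℕ-↑ʳ m j) ⟩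
      slot a p (suc m + (m + toℕ j))           ∎
      where open ≡-Reasoning

-- The inversion number of an ordered word

module _ {m : ℕ} where
  open Ordered

  module _ {π : Word (3 * suc m) (3 * suc m)} (ρ : Positions π) (ord : Ordered (posAt ρ)) where

    private
      t = suc m
      a = posAt ρ 1F zero
      p = posAt ρ 0F zero

      Inversion : Fin (3 * t) → Fin (3 * t) → Set
      Inversion y x = pos ρ x Fin.< pos ρ y × y Fin.< x

      label : Fin 3 → Fin t → Fin (3 * t)
      label = combine

      at : Fin 3 → Fin t → ℕ
      at r j = inversionsAt ρ (label r j)

      inRow : Fin (3 * t) → Fin 3 → ℕ
      inRow y r = ∑[ j < t ] indicator (inversion? ρ y (label r j))

    inversionsAt-rows : ∀ y {k₀ k₁ k₂} →
      inRow y 0F ≡ k₀ → inRow y 1F ≡ k₁ → inRow y 2F ≡ k₂ →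
      inversionsAt ρ y ≡ k₀ + (k₁ + (k₂ + 0))
    inversionsAt-rows y refl refl refl = sum-combine 3 {t} (λ x → indicator (inversion? ρ y x))

    inRow-none : ∀ y r → (∀ j → ¬ Inversion y (label r j)) → inRow y r ≡ 0
    inRow-none y r none = trans
      (sum-cong-≗ {t} (λ j → indicator-false (inversion? ρ y (label r j)) (none j)))
      (sum-replicate-zero t)

    inRow-all : ∀ y r → (∀ j → Inversion y (label r j)) → inRow y r ≡ t
    inRow-all y r all = trans
      (sum-cong-≗ {t} (λ j → indicator-true (inversion? ρ y (label r j)) (all j)))
      (trans (sum-const t 1) (ℕ.*-identityʳ t))

    no-inversion-in-row : ∀ r j j′ → ¬ Inversion (label r j) (label r j′)
    no-inversion-in-row r j j′ (before , above) with combine-cancel-< {3} {t} r r j j′ above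
    ... | inj₁ r<r        = ℕ.<-irrefl refl r<r
    ... | inj₂ (_ , j<j′) = ℕ.<-asym before (rows ord r j<j′)

    no-inversion-below : ∀ r r′ j j′ → r′ Fin.< r → ¬ Inversion (label r j) (label r′ j′)
    no-inversion-below r r′ j j′ r′<r (_ , above) =
      ℕ.<-asym above (Fin.combine-monoˡ-< {3} {t} j′ j r′<r)

    0<1 : Fin._<_ {3} {3} 0F 1F
    0<1 = s≤s z≤n

    0<2 : Fin._<_ {3} {3} 0F 2F
    0<2 = s≤s z≤n

    1<2 : Fin._<_ {3} {3} 1F 2F
    1<2 = s≤s (s≤s z≤n)

    at-2 : ∀ j → at 2F j ≡ 0
    at-2 j = inversionsAt-rows (label 2F j)
      (inRow-none _ 0F λ j′ → no-inversion-below 2F 0F j j′ 0<2)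
      (inRow-none _ 1F λ j′ → no-inversion-below 2F 1F j j′ 1<2)
      (inRow-none _ 2F (no-inversion-in-row 2F j))

    at-1 : ∀ j → at 1F (suc j) ≡ t
    at-1 j = trans
      (inversionsAt-rows (label 1F (suc j))
        (inRow-none _ 0F λ j′ → no-inversion-below 1F 0F (suc j) j′ 0<1)
        (inRow-none _ 1F (no-inversion-in-row 1F (suc j)))
        (inRow-all _ 2F λ j′ → a<b ord j′ j , Fin.combine-monoˡ-< {3} (suc j) j′ 1<2))
      (ℕ.+-identityʳ t)

    at-0 : ∀ j → at 0F (suc j) ≡ t + t
    at-0 j = trans
      (inversionsAt-rows (label 0F (suc j))
        (inRow-none _ 0F (no-inversion-in-row 0F (suc j)))
        (inRow-all _ 1F λ j′ → b<c ord j′ j , Fin.combine-monoˡ-< {3} (suc j) j′ 0<1)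
        (inRow-all _ 2F λ j′ → a<c ord j′ j , Fin.combine-monoˡ-< {3} (suc j) j′ 0<2))
      (cong (λ e → t + e) (ℕ.+-identityʳ t))

    -- Every earlier letter contributes, and a 0-based position is the number of earlier letters.
    -- This serves B₀, which only A's precede, and C₀, the least label; it is how `a` and `p` enter
    -- the inversion number.
    inversionsAt-all-before : ∀ y → (∀ x → pos ρ x Fin.< pos ρ y → y Fin.< x) →
                              inversionsAt ρ y ≡ toℕ (pos ρ y)
    inversionsAt-all-before y larger = begin
      inversionsAt ρ y
        ≡⟨ sum-cong-≗ (λ x → indicator-⇔ (inversion? ρ y x) (pos ρ x Fin.<? pos ρ y)
             proj₁ (λ lt → lt , larger x lt)) ⟩
      ∑[ x < 3 * t ] indicator (pos ρ x Fin.<? pos ρ y)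
        ≡⟨ sum-pos ρ (λ i → indicator (i Fin.<? pos ρ y)) ⟨
      ∑[ i < 3 * t ] indicator (i Fin.<? pos ρ y)
        ≡⟨ count-< (toℕ (pos ρ y)) (ℕ.<⇒≤ (Fin.toℕ<n (pos ρ y))) ⟩
      toℕ (pos ρ y) ∎
      where open ≡-Reasoning

    at-b₀ : at 1F zero ≡ a
    at-b₀ = inversionsAt-all-before _ larger
      where
      larger : ∀ x → pos ρ x Fin.< pos ρ (label 1F zero) → label 1F zero Fin.< x
      larger x lt with Fin.combine-surjective {3} {t} x
      ... | 0F , j , refl = contradiction lt (ℕ.<-asym (b₀<c ord j))
      ... | 1F , j , refl = contradiction lt (ℕ.≤⇒≯ (b₀≤b ord j))
      ... | 2F , j , refl = Fin.combine-monoˡ-< {3} zero j 1<2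

    at-c₀ : at 0F zero ≡ p
    at-c₀ = inversionsAt-all-before _ larger
      where
      larger : ∀ x → pos ρ x Fin.< pos ρ (label 0F zero) → label 0F zero Fin.< x
      larger zero    lt = contradiction lt (ℕ.<-irrefl refl)
      larger (suc x) lt = s≤s z≤n

    inv-ordered : inv π ≡ a + p + 3 * (m * t)
    inv-ordered = begin
      inv π
        ≡⟨ inv-sum ρ ⟩
      ∑[ y < 3 * t ] inversionsAt ρ y
        ≡⟨ sum-combine 3 {t} (inversionsAt ρ) ⟩
      sum (at 0F) + (sum (at 1F) + (sum (at 2F) + 0))
        ≡⟨ cong₂ _+_ (cong₂ _+_ at-c₀ (trans (sum-cong-≗ {m} at-0) (sum-const m (t + t))))
            (cong₂ _+_ (cong₂ _+_ at-b₀ (trans (sum-cong-≗ {m} at-1) (sum-const m t)))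
              (cong (_+ 0) (trans (sum-cong-≗ {t} at-2) (sum-replicate-zero t)))) ⟩
      p + m * (t + t) + (a + m * t + 0)
        ≡⟨ collect a p m t ⟩
      a + p + 3 * (m * t) ∎
      where
      open ≡-Reasoning
      collect : ∀ a p m t → p + m * (t + t) + (a + m * t + 0) ≡ a + p + 3 * (m * t)
      collect = ℕ-Solver.solve-∀

-- If t < a, the two skips would leave B₁ at position t, before B₀; if 2t < p, then C₁ would stay at
-- position 2t or less, before C₀. For t = 1 there is no B₁ or C₁, and the bounds follow from a < p
-- < 3 instead.
place-bounds : ∀ m {P : Fin 3 → Fin (suc m) → ℕ} (ord : Ordered P) →
  (∀ r j → P r j ≡ place (P 1F zero) (P 0F zero) r j) → P 0F zero < 3 * suc m →
  P 1F zero ≤ suc m × P 0F zero ≤ suc m + suc m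
place-bounds zero ord eq p<n =
  ℕ.≤-pred (ℕ.≤-trans (Ordered.b₀<c₀ ord) (ℕ.≤-pred p<n)) , ℕ.≤-pred p<n
place-bounds (suc m) {P} ord eq p<n =
  ℕ.≮⇒≥ (λ t<a → ℕ.<-asym t<a (ℕ.<-≤-trans a<slot (ℕ.≤-reflexive
    (trans (cong (slot-at a) (ℕ.+-identityʳ t)) (trans (cong (skip p) (skip-< t<a)) (skip-< (ℕ.<-trans t<a b₀<c₀)))))))
  , ℕ.≮⇒≥ (λ 2t<p → ℕ.<-asym p<slot (ℕ.≤-<-trans
      (ℕ.≤-reflexive (skip-< (ℕ.≤-<-trans skip≤2t 2t<p))) (ℕ.≤-<-trans skip≤2t 2t<p)))
  where
  open Ordered ord
  t = suc (suc m)
  a = P 1F zero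
  p = P 0F zero
  slot-at : ℕ → ℕ → ℕ
  slot-at a k = skip p (skip a k)
  a<slot : a < slot-at a (t + 0)
  a<slot = subst (a <_) (eq 1F (suc zero)) (rows 1F (s≤s z≤n))
  p<slot : p < slot-at a (t + (suc m + 0))
  p<slot = subst (p <_) (eq 0F (suc zero)) (rows 0F (s≤s z≤n))
  skip≤2t : skip a (t + (suc m + 0)) ≤ t + t
  skip≤2t = ℕ.≤-trans (skip≤1+x a _) (ℕ.≤-reflexive
    (trans (cong (λ e → suc (t + e)) (ℕ.+-identityʳ (suc m))) (sym (ℕ.+-suc t (suc m)))))

-- The words with given positions of B₀ and C₀

positions-determine : ∀ {n} {π π′ : Word n n} (ρ : Positions π) (ρ′ : Positions π′) →
                      (∀ y → pos ρ y ≡ pos ρ′ y) → π ≡ π′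
positions-determine {π = π} {π′} ρ ρ′ eq = begin
  π                          ≡⟨ Vec.tabulate∘lookup π ⟨
  Vec.tabulate (lookup π)    ≡⟨ Vec.tabulate-cong same ⟩
  Vec.tabulate (lookup π′)   ≡⟨ Vec.tabulate∘lookup π′ ⟩
  π′                         ∎
  where
  open ≡-Reasoning
  same : ∀ i → lookup π i ≡ lookup π′ i
  same i = begin
    lookup π i                           ≡⟨ cong (lookup π) (pos-lookup ρ′ i) ⟨
    lookup π (pos ρ′ (lookup π′ i))      ≡⟨ cong (lookup π) (eq (lookup π′ i)) ⟨
    lookup π (pos ρ (lookup π′ i))       ≡⟨ lookup-pos ρ (lookup π′ i) ⟩
    lookup π′ i                          ∎

pos-cong : ∀ {n} {π π′ : Word n n} (ρ : Positions π) (ρ′ : Positions π′) →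
           π ≡ π′ → ∀ y → pos ρ y ≡ pos ρ′ y
pos-cong ρ ρ′ refl y = trans (cong (pos ρ) (sym (lookup-pos ρ′ y))) (pos-lookup ρ (pos ρ′ y))

ordered-resp-≗ : ∀ {m} {P Q : Fin 3 → Fin (suc m) → ℕ} → (∀ r j → Q r j ≡ P r j) →
                 Ordered P → Ordered Q
ordered-resp-≗ {P = P} {Q} eq ord = record
  { rows  = λ r → tr ∘ rows r
  ; a₀<b₀ = tr a₀<b₀
  ; b₀<c₀ = tr b₀<c₀
  ; a<b   = λ j j′ → tr (a<b j j′)
  ; b<c   = λ j j′ → tr (b<c j j′)
  }
  where
  open Ordered ord
  tr : ∀ {r j r′ j′} → P r j < P r′ j′ → Q r j < Q r′ j′
  tr {r} {j} {r′} {j′} = subst₂ _<_ (sym (eq r j)) (sym (eq r′ j′))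

sumℤ-↭ : ∀ {xs ys} → xs ↭ ys → sumℤ xs ≡ sumℤ ys
sumℤ-↭ p = ↭ₛ.foldr-commMonoid (setoid ℤ) ℤ.+-0-isCommutativeMonoid (↭⇒↭ₛ p)

module _ (m : ℕ) where

  private
    t = suc m
    T = m + t
    n = 3 * t

  record Admissible (a p : ℕ) : Set where
    field
      0<a  : 0 < a
      a≤t  : a ≤ t
      a<p  : a < p
      p≤2t : p ≤ t + t

    p<n : p < n
    p<n = ℕ.≤-<-trans p≤2t (ℕ.+-monoʳ-< t (ℕ.m<m+n t (s≤s z≤n)))

  open Admissible

  module _ {a p : ℕ} (adm : Admissible a p) where

    private
      rowAt : Fin n → Fin 3
      rowAt i = proj₁ (place-surjective (a<p adm) (p<n adm) (Fin.toℕ<n i))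

      columnAt : Fin n → Fin t
      columnAt i = proj₁ (proj₂ (place-surjective (a<p adm) (p<n adm) (Fin.toℕ<n i)))

      place-cellAt : ∀ i → place a p (rowAt i) (columnAt i) ≡ toℕ i
      place-cellAt i = proj₂ (proj₂ (place-surjective (a<p adm) (p<n adm) (Fin.toℕ<n i)))

      labelAt : Fin n → Fin n
      labelAt i = combine (rowAt i) (columnAt i)

      labelAt⇒place : ∀ i r j → labelAt i ≡ combine r j → place a p r j ≡ toℕ i
      labelAt⇒place i r j eq
        with r≡ , j≡ ← Fin.combine-injective (rowAt i) (columnAt i) r j eq =
        trans (cong₂ (place a p) (sym r≡) (sym j≡)) (place-cellAt i)

      labelAt-injective : ∀ {i i′} → labelAt i ≡ labelAt i′ → i ≡ i′
      labelAt-injective {i} {i′} eq = Fin.toℕ-injective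
        (trans (sym (labelAt⇒place i (rowAt i′) (columnAt i′) eq)) (place-cellAt i′))

    abstract
      word : Word n n
      word = Vec.tabulate labelAt

      lookup-word : ∀ i → lookup word i ≡ labelAt i
      lookup-word = Vec.lookup∘tabulate labelAt

    wordPositions : Positions word
    wordPositions = injective⇒positions word λ {i} {i′} eq →
      labelAt-injective (trans (sym (lookup-word i)) (trans eq (lookup-word i′)))

    word-place : ∀ r j → posAt wordPositions r j ≡ place a p r j
    word-place r j = sym (labelAt⇒place (pos wordPositions (combine r j)) r j
      (trans (sym (lookup-word (pos wordPositions (combine r j)))) (lookup-pos wordPositions (combine r j))))

    word-ordered : Ordered (posAt wordPositions)
    word-ordered = ordered-resp-≗ word-place
      (place-ordered (0<a adm) (a≤t adm) (a<p adm) (p≤2t adm))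

    inv-word : inv word ≡ a + p + 3 * (m * t)
    inv-word = trans (inv-ordered wordPositions word-ordered)
      (cong₂ (λ a p → a + p + 3 * (m * t)) (word-place 1F zero) (word-place 0F zero))

    word∈EN : IsLinearExtension 3 t word × Avoids word pattern-1243
    word∈EN = ordered⇒isLinearExtension wordPositions word-ordered
            , ordered⇒¬occurs wordPositions word-ordered ∘ contains⁻ wordPositions

  -- `word` reads its cells off a surjectivity witness that depends on the admissibility proof. The
  -- positions of the letters do not, as they are given by `place`.
  word-irrelevant : ∀ {a p} (adm adm′ : Admissible a p) → word adm ≡ word adm′
  word-irrelevant adm adm′ = positions-determine (wordPositions adm) (wordPositions adm′)
    (λ y → Fin.toℕ-injective (same y))
    where
    same : ∀ y → toℕ (pos (wordPositions adm) y) ≡ toℕ (pos (wordPositions adm′) y)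
    same y with r , j , refl ← Fin.combine-surjective {3} {t} y =
      trans (word-place adm r j) (sym (word-place adm′ r j))

  word-injective : ∀ {a p a′ p′} (adm : Admissible a p) (adm′ : Admissible a′ p′) →
                   word adm ≡ word adm′ → a ≡ a′ × p ≡ p′
  word-injective {a} {p} {a′} {p′} adm adm′ eq = same 1F zero , same 0F zero
    where
    same : ∀ r j → place a p r j ≡ place a′ p′ r j
    same r j = begin
      place a p r j                              ≡⟨ word-place adm r j ⟨
      toℕ (pos (wordPositions adm) (combine r j))
        ≡⟨ cong toℕ (pos-cong (wordPositions adm) (wordPositions adm′) eq (combine r j)) ⟩
      toℕ (pos (wordPositions adm′) (combine r j)) ≡⟨ word-place adm′ r j ⟩
      place a′ p′ r j                            ∎
      where open ≡-Reasoning

  ordered⇒word : ∀ {π} (ρ : Positions π) → Ordered (posAt ρ) →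
                 ∃₂ λ a p → ∃ λ (adm : Admissible a p) → π ≡ word adm
  ordered⇒word {π} ρ ord = a , p , adm ,
    positions-determine ρ (wordPositions adm) (λ y → Fin.toℕ-injective (same y))
    where
    P : Fin 3 → Fin t → ℕ
    P = posAt ρ

    a = P 1F zero
    p = P 0F zero

    P-injective : ∀ {r j r′ j′} → P r j ≡ P r′ j′ → (r , j) ≡ (r′ , j′)
    P-injective {r} {j} {r′} {j′} eq
      with refl , refl ← Fin.combine-injective r j r′ j′ (pos-injective ρ (Fin.toℕ-injective eq)) = refl

    P<n : ∀ r j → P r j < n
    P<n r j = Fin.toℕ<n (pos ρ (combine r j))

    placed : ∀ r j → P r j ≡ place a p r j
    placed = ordered⇒place {m} {P} ord P-injective P<n

    bounds : a ≤ t × p ≤ t + t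
    bounds = place-bounds m {P} ord placed (P<n 0F zero)

    adm : Admissible a p
    adm = record
      { 0<a  = ℕ.≤-<-trans z≤n (Ordered.a₀<b₀ ord)
      ; a≤t  = proj₁ bounds
      ; a<p  = Ordered.b₀<c₀ ord
      ; p≤2t = proj₂ bounds
      }

    same : ∀ y → toℕ (pos ρ y) ≡ toℕ (pos (wordPositions adm) y)
    same y with r , j , refl ← Fin.combine-surjective {3} {t} y =
      trans (placed r j) (sym (word-place adm r j))

  complete : ∀ {π} → IsLinearExtension 3 t π → Avoids π pattern-1243 →
             ∃₂ λ a p → ∃ λ (adm : Admissible a p) → π ≡ word adm
  complete (perm , le) avoids =
    ordered⇒word (positions perm)
      (avoids⇒ordered (positions perm) le (avoids ∘ contains⁺ (positions perm)))

  -- Here c = a - 1 and k = p - a - 1. As T = 2t - 1, the condition p ≤ 2t becomes k < T - c, so the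
  -- pairs are indexed exactly as in `exponents`.
  admissible : ∀ (c : Fin t) (k : Fin (T ∸ toℕ c)) →
               Admissible (suc (toℕ c)) (suc (toℕ k + suc (toℕ c)))
  admissible c k = record
    { 0<a  = s≤s z≤n
    ; a≤t  = Fin.toℕ<n c
    ; a<p  = s≤s (ℕ.m≤n+m _ (toℕ k))
    ; p≤2t = s≤s (begin
        toℕ k + suc (toℕ c)     ≡⟨ ℕ.+-suc (toℕ k) (toℕ c) ⟩
        suc (toℕ k) + toℕ c     ≤⟨ ℕ.+-monoˡ-≤ (toℕ c) (Fin.toℕ<n k) ⟩
        T ∸ toℕ c + toℕ c       ≡⟨ ℕ.m∸n+n≡m c≤T ⟩
        T                       ∎)
    }
    where
    open ℕ.≤-Reasoning
    c≤T : toℕ c ≤ T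
    c≤T = ℕ.≤-trans (ℕ.<⇒≤ (Fin.toℕ<n c)) (ℕ.m≤n+m t m)

  admissible-index : ∀ {a p} → Admissible a p →
    ∃ λ (c : Fin t) → ∃ λ (k : Fin (T ∸ toℕ c)) → a ≡ suc (toℕ c) × p ≡ suc (toℕ k + suc (toℕ c))
  admissible-index {suc a} {suc p} adm = c , k , cong suc (sym toℕ-c) , cong suc (begin
      p                                 ≡⟨ ℕ.m∸n+n≡m (ℕ.≤-pred (a<p adm)) ⟨
      p ∸ suc a + suc a                 ≡⟨ cong₂ (λ x y → x + suc y) (Fin.toℕ-fromℕ< k<) toℕ-c ⟨
      toℕ k + suc (toℕ c)               ∎)
    where
    open ≡-Reasoning
    c : Fin t
    c = fromℕ< (a≤t adm)
    toℕ-c : toℕ c ≡ a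
    toℕ-c = Fin.toℕ-fromℕ< (a≤t adm)
    k< : p ∸ suc a < T ∸ toℕ c
    k< = subst (λ x → p ∸ suc a < T ∸ x) (sym toℕ-c)
      (ℕ.≤-trans (ℕ.≤-reflexive (sym (ℕ.+-∸-assoc 1 (ℕ.≤-pred (a<p adm)))))
                 (ℕ.∸-monoˡ-≤ a (ℕ.≤-pred (p≤2t adm))))
    k : Fin (T ∸ toℕ c)
    k = fromℕ< k<

  wordRow : Fin t → List (Word n n)
  wordRow c = tabulate λ k → word (admissible c k)

  admissibleWords : List (Word n n)
  admissibleWords = concat (tabulate wordRow)

  admissibleWords-unique : Unique admissibleWords
  admissibleWords-unique = Unique.concat⁺
    (All.tabulate⁺ λ c → Unique.tabulate⁺ λ {k} {k′} eq →
      Fin.toℕ-injective (ℕ.+-cancelʳ-≡ _ _ _ (ℕ.suc-injective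
        (proj₂ (word-injective (admissible c k) (admissible c k′) eq)))))
    (AllPairs.tabulate⁺ λ {c} {c′} c≢c′ (w∈ , w∈′) → disjoint c≢c′ (∈-tabulate⁻ w∈) (∈-tabulate⁻ w∈′))
    where
    disjoint : ∀ {c c′ w} → c ≢ c′ → ∃ (λ k → w ≡ word (admissible c k)) →
               ¬ ∃ (λ k → w ≡ word (admissible c′ k))
    disjoint {c} {c′} c≢c′ (k , eq) (k′ , eq′) = c≢c′ (Fin.toℕ-injective (ℕ.suc-injective
      (proj₁ (word-injective (admissible c k) (admissible c′ k′) (trans (sym eq) eq′)))))

  word∈admissibleWords : ∀ {a p} (adm : Admissible a p) → word adm ∈ admissibleWords
  word∈admissibleWords adm with c , k , refl , refl ← admissible-index adm =
    subst (_∈ admissibleWords) (word-irrelevant (admissible c k) adm)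
      (∈-concat⁺′ (∈-tabulate⁺ {f = λ k → word (admissible c k)} k) (∈-tabulate⁺ {f = wordRow} c))

  admissibleWords⊆EN : ∀ {π} → π ∈ admissibleWords → IsLinearExtension 3 t π × Avoids π pattern-1243
  admissibleWords⊆EN π∈ =
    let ws , π∈ws , ws∈ = ∈-concat⁻′ (tabulate wordRow) π∈
        c , ws≡         = ∈-tabulate⁻ {f = wordRow} ws∈
        k , π≡          = ∈-tabulate⁻ {f = λ k → word (admissible c k)} (subst (_ ∈_) ws≡ π∈ws)
    in subst (λ π → IsLinearExtension 3 t π × Avoids π pattern-1243) (sym π≡) (word∈EN (admissible c k))

  EN⊆admissibleWords : ∀ {π} → IsLinearExtension 3 t π × Avoids π pattern-1243 → π ∈ admissibleWords
  EN⊆admissibleWords (le , avoids) =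
    let a , p , adm , π≡ = complete le avoids
    in subst (_∈ admissibleWords) (sym π≡) (word∈admissibleWords adm)

  -- Neither list has duplicates and they have the same members, so each sum over one is a
  -- rearrangement of the sum over the other.
  EN↭admissibleWords : EN 3 t pattern-1243 ↭ admissibleWords
  EN↭admissibleWords = ∼bag⇒↭ (unique∧set⇒bag
    (EN-unique 3 t pattern-1243) admissibleWords-unique
    (mk⇔ (EN⊆admissibleWords ∘ Equivalence.to (∈-EN 3 t pattern-1243))
         (Equivalence.from (∈-EN 3 t pattern-1243) ∘ admissibleWords⊆EN)))

  -- The generating function

  private
    -- The smallest inversion number: the 3 is a + p for a = 1 and p = 2.
    N = 3 + 3 * (m * t)

  open GeneratingFunction N T

  inv-admissibleWords : map inv admissibleWords ≡ exponents t
  inv-admissibleWords = begin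
    map inv (concat (tabulate wordRow))
      ≡⟨ List.concat-map (tabulate wordRow) ⟨
    concat (map (map inv) (tabulate wordRow))
      ≡⟨ cong concat (List.map-tabulate wordRow (map inv)) ⟩
    concat (tabulate (map inv ∘ wordRow))
      ≡⟨ cong concat (List.tabulate-cong λ c → trans
           (List.map-tabulate (λ k → word (admissible c k)) inv)
           (List.tabulate-cong λ k → trans (inv-word (admissible c k))
             (collect (toℕ c) (toℕ k) (3 * (m * t))))) ⟩
    exponents t ∎
    where
    open ≡-Reasoning
    collect : ∀ c k M → suc c + suc (k + suc c) + M ≡ k + (c * 2 + (3 + M))
    collect = ℕ-Solver.solve-∀

  EN-*D : ∀ x → coeff (EN[q] 3 t pattern-1243 *ₚ D) x ≡ g x 0 ℤ.- g x t
  EN-*D x = begin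
    coeff (sumₚ (map (λ π → q^ inv π) (EN 3 t pattern-1243)) *ₚ D) x
      ≡⟨ sum-*D (map (λ π → q^ inv π) (EN 3 t pattern-1243)) x ⟩
    sumℤ (map F (map (λ π → q^ inv π) (EN 3 t pattern-1243)))
      ≡⟨ sumℤ-↭ (map⁺ F (map⁺ (λ π → q^ inv π) EN↭admissibleWords)) ⟩
    sumℤ (map F (map (λ π → q^ inv π) admissibleWords))
      ≡⟨ sum-*D (map (λ π → q^ inv π) admissibleWords) x ⟨
    coeff (sumₚ (map (λ π → q^ inv π) admissibleWords) *ₚ D) x
      ≡⟨ cong (λ ps → coeff (sumₚ ps *ₚ D) x)
           (trans (List.map-∘ admissibleWords) (cong (map q^_) inv-admissibleWords)) ⟩
    coeff (sumₚ (map q^_ (exponents t)) *ₚ D) x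
      ≡⟨ coeff-sum x t (s≤s (ℕ.≤-trans (ℕ.n≤1+n m) (ℕ.m≤n+m t m))) ⟩
    g x 0 ℤ.- g x t ∎
    where
    open ≡-Reasoning
    F : Poly → ℤ
    F p = coeff (p *ₚ D) x

  -- With t = `suc m` the truncated subtractions are genuine: t^2 - t is `m * t`, while 2t - 1 and
  -- 3t - 1 are `T` and `t + T`.
  numerator≡ : q^ (3 * (t ^ 2 ∸ t + 1))
      *ₚ (1ₚ -ₚ q^ (2 * t ∸ 1) -ₚ (+ 2) ·ₚ q^ (2 * t) +ₚ q^ (3 * t ∸ 1) +ₚ q^ (3 * t))
    ≡ q^ N *ₚ bracket T (suc T) (t + T) (suc (t + T))
  numerator≡ = cong₂ (λ e b → q^ e *ₚ b) exponent
    (cong₂ (λ 2t 3t → bracket (2t ∸ 1) 2t (3t ∸ 1) 3t) 2t≡ 3t≡)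
    where
    2t≡ : 2 * t ≡ suc T
    2t≡ = cong (λ e → t + e) (ℕ.+-identityʳ t)
    3t≡ : 3 * t ≡ suc (t + T)
    3t≡ = trans (cong (λ e → t + e) 2t≡) (ℕ.+-suc t T)
    exponent : 3 * (t ^ 2 ∸ t + 1) ≡ N
    exponent = trans
      (cong (λ e → 3 * (e + 1)) (trans (cong (λ e → t * e ∸ t) (ℕ.*-identityʳ t)) (ℕ.m+n∸m≡n t (m * t))))
      (distribute (m * t))
      where
      distribute : ∀ M → 3 * (M + 1) ≡ 3 + 3 * M
      distribute = ℕ-Solver.solve-∀

theorem3p1 : ∀ (t : ℕ) → t ≥ 1 →
    fromPoly (EN[q] 3 t (# 0 ∷ # 1 ∷ # 3 ∷ # 2 ∷ []))
    ≃ (q^ (3 * (t ^ 2 ∸ t + 1))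
    *ₚ (1ₚ -ₚ q^ (2 * t ∸ 1) -ₚ (+ 2) ·ₚ q^ (2 * t) +ₚ q^ (3 * t ∸ 1) +ₚ q^ (3 * t)))
    /ₚ ((1ₚ -ₚ q^ 1) *ₚ (1ₚ -ₚ q^ 2))
theorem3p1 t@(suc m) _ x = trans (EN-*D m x) (sym (trans
  (cong (λ p → coeff (p *ₚ 1ₚ) x) (numerator≡ m))
  (coeff-numerator (3 + 3 * (m * t)) (m + t) t x (trans (ℕ.*-comm t 2) (cong (λ e → t + e) (ℕ.+-identityʳ t))))))
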